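{- Let $G$ be a connected block graph on $n$ vertices with set of cut vertices $V_c(G)$, and let $k$ be an integer with $2\le k\le n$. Then $$SW_k(G)=\sum_{v\in V_c(G)} N_k(G\setminus v) + (k-1)\binom{n}{k}.$$
   Context: A block graph is a graph in which every block (maximal connected induced subgraph without cut vertices) is a clique. For connected $G$ and $S\subseteq V(G)$, the Steiner distance $d(S)$ is the minimum number of edges of a connected subgraph of $G$ whose vertex set contains $S$, and $SW_k(G)=\sum_{S\subseteq V(G),|S|=k} d(S)$. $G\setminus v$ is the graph obtained by deleting vertex $v$. For a graph $H$ with $p>1$ connected components $H_1,\dots,H_p$, $$N_k(H)=\sum_{\substack{l_1+\cdots+l_p=k\\0\le l_1,\dots,l_p<k}}\binom{|V(H_1)|}{l_1}\cdots\binom{|V(H_p)|}{l_p},$$ i.e. the number of $k$-subsets of $V(H)$ not contained in a single component; conventions $\binom{m}{0}=1$, $\binom{m}{l}=0$ for $m<l$. -}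

module Defs where

open import Level using (0ℓ) renaming (suc to lsuc)
open import Data.Fin using (Fin; _<?_)
open import Data.Fin.Properties using (any?; all?)
open import Data.Fin.Subset using (Subset; inside; outside; _∈_; _∉_; _⊆_; _⊂_; _∩_; _∪_; _-_; ⁅_⁆; ∣_∣; Nonempty)
open import Data.Fin.Subset.Properties
  using (_∈?_; _⊆?_; nonempty?; x∈p∩q⁺; x∈p∩q⁻; x∈p∪q⁺; x∈p∪q⁻; p⊆p∪q; x∈⁅x⁆; x∈⁅y⁆⇒x≡y)
open import Data.Fin.Subset.Induction using (⊃-wellFounded; Acc; acc)
open import Data.List using (List; []; _∷_; map; filter; length; upTo; allFin; cartesianProduct; cartesianProductWith)
open import Data.List.Extrema.Nat using (min; argmin-sel; min≤v⁺)
import Data.List.Membership.Propositional as List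
open import Data.List.Membership.Propositional.Properties
  using (∈-map⁺; ∈-map⁻; ∈-filter⁺; ∈-filter⁻; ∈-cartesianProductWith⁺; ∈-cartesianProductWith⁻)
open import Data.List.Properties using (filter-≐)
open import Data.List.Relation.Unary.Any using (here; there)
import Data.List.Relation.Unary.Any as Any
open import Data.Nat using (ℕ; zero; suc; _*_; _≤_; _<_)
import Data.Nat.Properties as ℕ
open import Data.Nat.Combinatorics using (_C_)
open import Data.Nat.ListAction using (sum)
open import Data.Product using (Σ; ∃; _×_; _,_; proj₁; proj₂)
open import Data.Sum using (inj₁; inj₂)
open import Data.Vec as Vec using (Vec; []; _∷_; lookup; tabulate)
open import Data.Vec.Properties using (lookup∘tabulate; []=⇒lookup; lookup⇒[]=)
open import Function using (_⇔_; mk⇔; Equivalence; id)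
open import Relation.Binary using (Decidable)
open import Relation.Binary.Construct.Closure.ReflexiveTransitive using (Star; ε; _◅_; _◅◅_; gmap)
open import Relation.Binary.PropositionalEquality using (_≡_; _≢_; refl; sym; trans; cong; subst)
open import Relation.Nullary using (¬_; Dec; yes; no; does)
open import Relation.Nullary.Decidable using (_×-dec_; _→-dec_; map′; dec-true; ¬?; decidable-stable)

-- A finite simple graph whose vertices are drawn from Fin m.  The vertex set
-- may be a proper subset, so that a graph, its subgraphs and its
-- vertex-deleted subgraphs all have type Graph m.
record Graph (m : ℕ) : Set (lsuc 0ℓ) where
  infix 4 _~_ _~?_
  field
    V        : Subset m
    _~_      : Fin m → Fin m → Set
    _~?_     : Decidable _~_
    ~-sym    : ∀ {u v} → u ~ v → v ~ u
    ~-irrefl : ∀ {v} → ¬ (v ~ v)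
    ~-vertex : ∀ {u v} → u ~ v → u ∈ V

open Graph public using (V)

-- u and v are joined by a walk.
Reach : ∀ {m} → Graph m → Fin m → Fin m → Set
Reach G = Star (Graph._~_ G)

Connected : ∀ {m} → Graph m → Set
Connected G = Nonempty (V G) × (∀ u v → u ∈ V G → v ∈ V G → Reach G u v)

Complete : ∀ {m} → Graph m → Set
Complete G = ∀ u v → u ∈ V G → v ∈ V G → u ≢ v → Graph._~_ G u v

-- The number of edges; each edge is counted at its ordered pair (u , v) with u < v.
size : ∀ {m} → Graph m → ℕ
size {m} G = length (filter (λ e → (proj₁ e <? proj₂ e) ×-dec (proj₁ e ~? proj₂ e))
                            (cartesianProduct (allFin m) (allFin m)))
  where open Graph G hiding (V)

infix 4 _⊑_
_⊑_ : ∀ {m} → Graph m → Graph m → Set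
H ⊑ G = V H ⊆ V G × (∀ u v → Graph._~_ H u v → Graph._~_ G u v)

induced : ∀ {m} → Graph m → Subset m → Graph m
induced G W = record
  { V        = V G ∩ W
  ; _~_      = λ u v → u ~ v × u ∈ W × v ∈ W
  ; _~?_     = λ u v → (u ~? v) ×-dec (u ∈? W) ×-dec (v ∈? W)
  ; ~-sym    = λ (e , p , q) → ~-sym e , q , p
  ; ~-irrefl = λ (e , _) → ~-irrefl e
  ; ~-vertex = λ (e , p , _) → x∈p∩q⁺ (~-vertex e , p)
  } where open Graph G hiding (V)

infixl 5 _∖_
_∖_ : ∀ {m} → Graph m → Fin m → Graph m
G ∖ v = induced G (V G - v)

vectors : ∀ {A : Set} → List A → ∀ n → List (Vec A n)
vectors xs zero    = [] ∷ []
vectors xs (suc n) = cartesianProductWith _∷_ xs (vectors xs n)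

subsets : ∀ m → List (Subset m)
subsets = vectors (inside ∷ outside ∷ [])

private
  reachSet : ∀ {m} (G : Graph m) u → Σ (Subset m) λ X → ∀ v → v ∈ X ⇔ Reach G u v
  reachSet {m} G u = grow ⁅ u ⁆ (⊃-wellFounded _) (x∈⁅x⁆ u)
                       (λ v v∈ → subst (Reach G u) (sym (x∈⁅y⁆⇒x≡y u v∈)) ε)
    where
    open Graph G hiding (V)
    closed : ∀ X → ¬ (∃ λ x → ∃ λ y → x ∈ X × y ∉ X × x ~ y) →
             ∀ {x y} → x ∈ X → Reach G x y → y ∈ X
    closed X no-exit x∈X ε = x∈X
    closed X no-exit {x} x∈X (_◅_ {j = y} e es) = closed X no-exit
      (decidable-stable (y ∈? X) (λ y∉X → no-exit (x , y , x∈X , y∉X , e))) es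
    grow : ∀ X → Acc (λ P Q → Q ⊂ P) X → u ∈ X → (∀ v → v ∈ X → Reach G u v) →
           Σ (Subset m) λ X → ∀ v → v ∈ X ⇔ Reach G u v
    grow X (acc rec) u∈X sound
      with any? (λ x → any? (λ y → (x ∈? X) ×-dec ¬? (y ∈? X) ×-dec (x ~? y)))
    ... | no no-exit = X , λ v → mk⇔ (sound v) (closed X no-exit u∈X)
    ... | yes (x , y , x∈X , y∉X , e) =
      grow (X ∪ ⁅ y ⁆)
           (rec (p⊆p∪q ⁅ y ⁆ , y , x∈p∪q⁺ (inj₂ (x∈⁅x⁆ y)) , y∉X))
           (p⊆p∪q ⁅ y ⁆ u∈X) sound′
      where
      sound′ : ∀ v → v ∈ X ∪ ⁅ y ⁆ → Reach G u v
      sound′ v v∈ with x∈p∪q⁻ X ⁅ y ⁆ v∈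
      ... | inj₁ v∈X = sound v v∈X
      ... | inj₂ v∈y with x∈⁅y⁆⇒x≡y y v∈y
      ...   | refl = sound x x∈X ◅◅ (e ◅ ε)

reach? : ∀ {m} (G : Graph m) → Decidable (Reach G)
reach? G u v with reachSet G u
... | X , X⇔ = map′ (Equivalence.to (X⇔ v)) (Equivalence.from (X⇔ v)) (v ∈? X)

connected? : ∀ {m} (G : Graph m) → Dec (Connected G)
connected? G = nonempty? (V G) ×-dec
  all? (λ u → all? (λ v → (u ∈? V G) →-dec ((v ∈? V G) →-dec reach? G u v)))

IsComponent : ∀ {m} → Graph m → Subset m → Set
IsComponent G X = ∃ λ u → u ∈ V G × (∀ v → (v ∈ X → Reach G u v) × (Reach G u v → v ∈ X))

isComponent? : ∀ {m} (G : Graph m) (X : Subset m) → Dec (IsComponent G X)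
isComponent? G X = any? (λ u → (u ∈? V G) ×-dec
  all? (λ v → ((v ∈? X) →-dec reach? G u v) ×-dec (reach? G u v →-dec (v ∈? X))))

-- The vertex sets of the connected components, each listed once.
components : ∀ {m} → Graph m → List (Subset m)
components {m} G = filter (isComponent? G) (subsets m)

CutVertex : ∀ {m} → Graph m → Fin m → Set
CutVertex G v = v ∈ V G × length (components G) < length (components (G ∖ v))

cutVertex? : ∀ {m} (G : Graph m) v → Dec (CutVertex G v)
cutVertex? G v = (v ∈? V G) ×-dec (length (components G) ℕ.<? length (components (G ∖ v)))

cutVertices : ∀ {m} → Graph m → List (Fin m)
cutVertices {m} G = filter (cutVertex? G) (allFin m)

Nonseparable : ∀ {m} → Graph m → Set
Nonseparable G = Connected G × (∀ v → ¬ CutVertex G v)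

IsBlock : ∀ {m} → Graph m → Subset m → Set
IsBlock G B = B ⊆ V G × Nonseparable (induced G B) ×
  (∀ B′ → B′ ⊆ V G → Nonseparable (induced G B′) → B ⊆ B′ → B′ ⊆ B)

BlockGraph : ∀ {m} → Graph m → Set
BlockGraph G = ∀ B → IsBlock G B → Complete (induced G B)

-- Every pair (W , M) is made into a subgraph of G by discarding from W what is
-- not a vertex of G and from M what is not an edge of G inside W.
subgraph : ∀ {m} → Graph m → Subset m → Vec (Subset m) m → Graph m
subgraph G W M = record
  { V        = V G ∩ W
  ; _~_      = λ u v → u ~ᵂ v × v ∈ lookup M u × u ∈ lookup M v
  ; _~?_     = λ u v → (u ~ᵂ? v) ×-dec (v ∈? lookup M u) ×-dec (u ∈? lookup M v)
  ; ~-sym    = λ (e , p , q) → ~ᵂ-sym e , q , p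
  ; ~-irrefl = λ (e , _) → ~ᵂ-irrefl e
  ; ~-vertex = λ (e , _) → ~ᵂ-vertex e
  } where open Graph (induced G W) hiding (V) renaming
            (_~_ to _~ᵂ_; _~?_ to _~ᵂ?_; ~-sym to ~ᵂ-sym; ~-irrefl to ~ᵂ-irrefl; ~-vertex to ~ᵂ-vertex)

-- All subgraphs of G, with repetitions.
subgraphs : ∀ {m} → Graph m → List (Graph m)
subgraphs {m} G = cartesianProductWith (subgraph G) (subsets m) (vectors (subsets m) m)

-- The first argument of min is its value on an empty list.  It plays no role
-- when G is connected and S ⊆ V G, as G itself is then one of the subgraphs
-- minimised over; see steinerDistance-spec.
steinerDistance : ∀ {m} → Graph m → Subset m → ℕ
steinerDistance G S =
  min (size G) (map size (filter (λ H → connected? H ×-dec (S ⊆? V H)) (subgraphs G)))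

SW : ∀ {m} → ℕ → Graph m → ℕ
SW {m} k G = sum (map (steinerDistance G)
  (filter (λ S → (S ⊆? V G) ×-dec (∣ S ∣ ℕ.≟ k)) (subsets m)))

-- All (l₁ , … , lₚ) with 0 ≤ lᵢ < k and l₁ + ⋯ + lₚ = k.
splittings : ∀ p → ℕ → List (Vec ℕ p)
splittings p k = filter (λ l → Vec.sum l ℕ.≟ k) (vectors (upTo k) p)

N : ∀ {m} → ℕ → Graph m → ℕ
N k H = sum (map (λ l → Vec.foldr′ _*_ 1 (Vec.zipWith _C_ orders l))
                 (splittings (length (components H)) k))
  where
  orders : Vec ℕ (length (components H))
  orders = Vec.map ∣_∣ (Vec.fromList (components H))

vectors-complete : ∀ {A : Set} {xs : List A} → (∀ x → x List.∈ xs) →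
                   ∀ {n} (v : Vec A n) → v List.∈ vectors xs n
vectors-complete all []      = here refl
vectors-complete all (x ∷ v) = ∈-cartesianProductWith⁺ _∷_ (all x) (vectors-complete all v)

subsets-complete : ∀ {m} (S : Subset m) → S List.∈ subsets m
subsets-complete = vectors-complete λ { inside → here refl ; outside → there (here refl) }

subgraphs-sound : ∀ {m} (G : Graph m) {H} → H List.∈ subgraphs G → H ⊑ G
subgraphs-sound {m} G H∈ with ∈-cartesianProductWith⁻ (subgraph G) (subsets m) _ H∈
... | W , M , _ , _ , refl =
  (λ x∈ → proj₁ (x∈p∩q⁻ (V G) W x∈)) , λ _ _ ((e , _) , _) → e

subgraphs-complete : ∀ {m} (G H : Graph m) → H ⊑ G →
  ∃ λ H′ → H′ List.∈ subgraphs G × H′ ⊑ H × H ⊑ H′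
subgraphs-complete {m} G H (V⊆ , E⊆) = H′ , H′∈ ,
  ((λ x∈ → proj₂ (x∈p∩q⁻ (V G) (V H) x∈)) , λ _ _ (_ , v∈ , _) → fromM v∈) ,
  ((λ x∈ → x∈p∩q⁺ (V⊆ x∈ , x∈)) ,
   λ u v e → (E⊆ u v e , ~-vertex e , ~-vertex (~-sym e)) , toM e , toM (~-sym e))
  where
  open Graph H using (_~_; _~?_; ~-sym; ~-vertex)
  row : Fin m → Subset m
  row u = tabulate (λ v → does (u ~? v))
  M : Vec (Subset m) m
  M = tabulate row
  H′ : Graph m
  H′ = subgraph G (V H) M
  H′∈ : H′ List.∈ subgraphs G
  H′∈ = ∈-cartesianProductWith⁺ (subgraph G) (subsets-complete (V H))
          (vectors-complete subsets-complete M)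
  entry : ∀ u v → lookup (lookup M u) v ≡ does (u ~? v)
  entry u v = trans (cong (λ r → lookup r v) (lookup∘tabulate row u)) (lookup∘tabulate _ v)
  toM : ∀ {u v} → u ~ v → v ∈ lookup M u
  toM {u} {v} e = lookup⇒[]= v _ (trans (entry u v) (dec-true (u ~? v) e))
  fromM : ∀ {u v} → v ∈ lookup M u → u ~ v
  fromM {u} {v} v∈ with u ~? v | trans (sym (entry u v)) ([]=⇒lookup v∈)
  ... | yes e | _ = e
  ... | no _  | ()

size-cong : ∀ {m} (G H : Graph m) → G ⊑ H → H ⊑ G → size G ≡ size H
size-cong {m} G H (_ , f) (_ , g) = cong length
  (filter-≐ _ _ ((λ (lt , e) → lt , f _ _ e) , (λ (lt , e) → lt , g _ _ e))
    (cartesianProduct (allFin m) (allFin m)))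

connected-cong : ∀ {m} (G H : Graph m) → G ⊑ H → H ⊑ G → Connected G → Connected H
connected-cong G H (V⊆ , f) (V⊇ , _) ((x , x∈) , reach) =
  (x , V⊆ x∈) , λ u v u∈ v∈ → gmap id (f _ _) (reach u v (V⊇ u∈) (V⊇ v∈))

record IsSteinerDistance {m} (G : Graph m) (S : Subset m) (d : ℕ) : Set (lsuc 0ℓ) where
  field
    attained : ∃ λ H → H ⊑ G × Connected H × S ⊆ V H × size H ≡ d
    minimal  : ∀ H → H ⊑ G → Connected H → S ⊆ V H → d ≤ size H

steinerDistance-spec : ∀ {m} (G : Graph m) → Connected G → ∀ S → S ⊆ V G →
                       IsSteinerDistance G S (steinerDistance G S)
steinerDistance-spec {m} G conn S S⊆ = record { attained = attained ; minimal = minimal }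
  where
  P? : (H : Graph m) → Dec (Connected H × S ⊆ V H)
  P? H = connected? H ×-dec (S ⊆? V H)
  sizes : List ℕ
  sizes = map size (filter P? (subgraphs G))
  attained : ∃ λ H → H ⊑ G × Connected H × S ⊆ V H × size H ≡ min (size G) sizes
  attained with argmin-sel id (size G) sizes
  ... | inj₁ eq = G , (id , λ _ _ e → e) , conn , S⊆ , sym eq
  ... | inj₂ ∈sizes with ∈-map⁻ size ∈sizes
  ...   | H , H∈ , eq with ∈-filter⁻ P? {xs = subgraphs G} H∈
  ...     | H∈′ , cH , S⊆H = H , subgraphs-sound G H∈′ , cH , S⊆H , sym eq
  minimal : ∀ H → H ⊑ G → Connected H → S ⊆ V H → min (size G) sizes ≤ size H
  minimal H H⊑G cH S⊆H with subgraphs-complete G H H⊑G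
  ... | H′ , H′∈ , below , above =
    min≤v⁺ (size G) sizes (inj₂ (Any.map (λ eq → ℕ.≤-reflexive (trans (sym eq) (size-cong H′ H below above)))
      (∈-map⁺ size (∈-filter⁺ P? H′∈ (connected-cong H H′ above below cH , λ x∈ → proj₁ above (S⊆H x∈))))))

{-# OPTIONS --safe #-}

-- A vertex v outside S separates S if S lies in no single component of G ∖ v.  The theorem is the
-- sum over all k-sets S of the formula d(S) + 1 = |S| + #{v : v separates S}: exchanging the order of
-- summation, N k (G ∖ v) counts the k-sets separated by v, and only cut vertices separate anything.
-- A connected subgraph containing S contains every separator of S, which bounds d(S) from below.
-- For the upper bound take an inclusion-minimal X ⊇ S inducing a connected subgraph, and a
-- spanning tree of it: in a block graph every vertex of X outside S separates S, because two
-- neighbours of v that are joined in G ∖ v lie on a cycle through v, hence in a block, and are adjacent.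
module Submission where

open import Defs
open import Data.Bool using (true; false; if_then_else_)
import Data.Empty as Empty
open import Data.Fin using (Fin; zero; suc; _<?_) renaming (_<_ to _<ᶠ_)
open import Data.Fin.Properties using (any?; all?; <-cmp) renaming (_≟_ to _≟ᶠ_)
open import Data.Fin.Subset using (Subset; inside; outside; ⊥; _∈_; _∉_; _⊆_; _⊈_; _⊂_; _∩_; _∪_; _-_; ∣_∣; ⋃; ⁅_⁆; Nonempty)
open import Data.Fin.Subset.Induction using (⊃-wellFounded; ⊂-wellFounded; Acc; acc)
open import Data.Fin.Subset.Properties
open import Data.List using (List; []; _∷_; _++_; _∷ʳ_; map; filter; length; upTo; allFin; tabulate; cartesianProduct; cartesianProductWith)
open import Data.List.Membership.Propositional using () renaming (_∈_ to _∈ˡ_)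
open import Data.List.Membership.Propositional.Properties using (∈-filter⁺; ∈-filter⁻; ∈-allFin; ∈-cartesianProduct⁺)
open import Data.List.Properties using (map-cong; map-++; map-∘; map-tabulate; upTo-∷ʳ)
open import Data.List.Relation.Unary.All as All using (All; []; _∷_)
open import Data.List.Relation.Unary.All.Properties using (all-filter)
open import Data.List.Relation.Unary.AllPairs using (AllPairs; []; _∷_)
open import Data.List.Relation.Unary.Any using (here; there)
open import Data.List.Relation.Unary.Unique.Propositional using (Unique)
import Data.List.Relation.Unary.Unique.Propositional.Properties as Unique
open import Data.Nat using (ℕ; zero; suc; _+_; _*_; _∸_; _≤_; _<_; z≤n; s≤s; s≤s⁻¹)
open import Data.Nat.Combinatorics using (_C_; nCk+nC[k+1]≡[n+1]C[k+1])
open import Data.Nat.ListAction using (sum)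
open import Data.Nat.ListAction.Properties using (sum-++)
import Data.Nat.Properties as ℕ
open import Data.Nat.Tactic.RingSolver using (solve-∀)
open import Data.Product using (Σ; ∃; _×_; _,_; proj₁; proj₂)
open import Data.Product.Properties using (≡-dec)
open import Data.Sum as Sum using (_⊎_; inj₁; inj₂)
open import Data.Vec as Vec using (Vec; []; _∷_; here; there)
open import Data.Vec.Properties using (lookup∘tabulate; []=⇒lookup; lookup⇒[]=; ∷-injective)
open import Function using (_∘_; id; _⇔_; mk⇔; Equivalence)
open import Relation.Binary using (tri<; tri≈; tri>; DecidableEquality)
open import Relation.Binary.Construct.Closure.ReflexiveTransitive using (ε; _◅_; _◅◅_; gmap; reverse)
open import Relation.Binary.PropositionalEquality
open import Relation.Nullary using (¬_; Dec; yes; no; does; contradiction)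
open import Relation.Nullary.Decidable using (_×-dec_; _⊎-dec_; ¬?; does-⇔; dec-true; dec-false; decidable-stable)
open import Relation.Unary using (Decidable; Pred)

-- Both bounds on the Steiner distance really count vertices: a connected graph has at least one
-- edge fewer than it has vertices, and a spanning tree attains this. Hence the formula is one for
-- `d(S) + 1`, and the factor `k - 1` of the theorem is the size of `S` less one. Blocks are defined
-- through cut vertices, and these through numbers of components, so the block hypothesis becomes
-- usable only by exhibiting an induced subgraph without cut vertices. A cycle supplies it, and the
-- resulting edge between two neighbours of `v` is a bypass of `v`. `N` is a sum over tuples of
-- sizes and not a count of sets. To identify the two, the subsets of a disjoint union are grouped
-- by the sizes of their traces. The induction on the list of components carries an arbitrary weight
-- of the total size, because splitting off one component shifts that total.

private variable
  A B P Q R : Set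
  m : ℕ
  G H K : Graph m
  S X : Subset m
  u v w x y z : Fin m

-- Sums and indicators

∑ : List A → (A → ℕ) → ℕ
∑ xs f = sum (map f xs)

⟦_⟧ : Dec P → ℕ
⟦ d ⟧ = if does d then 1 else 0

⟦⟧-cong : P ⇔ Q → (p : Dec P) (q : Dec Q) → ⟦ p ⟧ ≡ ⟦ q ⟧
⟦⟧-cong P⇔Q p q = cong (if_then 1 else 0) (does-⇔ P⇔Q p q)

⟦⟧-yes : (p : Dec P) → P → ⟦ p ⟧ ≡ 1
⟦⟧-yes p x = cong (if_then 1 else 0) (dec-true p x)

⟦⟧-no : (p : Dec P) → ¬ P → ⟦ p ⟧ ≡ 0
⟦⟧-no p ¬x = cong (if_then 1 else 0) (dec-false p ¬x)

⟦⟧-× : (p : Dec P) (q : Dec Q) → ⟦ p ×-dec q ⟧ ≡ ⟦ p ⟧ * ⟦ q ⟧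
⟦⟧-× p q with does p
... | true  = sym (ℕ.+-identityʳ ⟦ q ⟧)
... | false = refl

⟦⟧-mono : (P → Q) → (p : Dec P) (q : Dec Q) → ⟦ p ⟧ ≤ ⟦ q ⟧
⟦⟧-mono P⇒Q (no _)  q = z≤n
⟦⟧-mono P⇒Q (yes x) q = ℕ.≤-reflexive (sym (⟦⟧-yes q (P⇒Q x)))

⟦⟧-≤-+ : (R → P ⊎ Q) → (p : Dec P) (q : Dec Q) (r : Dec R) → ⟦ r ⟧ ≤ ⟦ p ⟧ + ⟦ q ⟧
⟦⟧-≤-+ R⇒P⊎Q p q (no _) = z≤n
⟦⟧-≤-+ R⇒P⊎Q p q (yes x) with R⇒P⊎Q x
... | inj₁ a = ℕ.≤-trans (ℕ.≤-reflexive (sym (⟦⟧-yes p a))) (ℕ.m≤m+n ⟦ p ⟧ ⟦ q ⟧)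
... | inj₂ b = ℕ.≤-trans (ℕ.≤-reflexive (sym (⟦⟧-yes q b))) (ℕ.m≤n+m ⟦ q ⟧ ⟦ p ⟧)

⟦⟧-+-≤ : (P → R) → (Q → R) → (P → ¬ Q) → (p : Dec P) (q : Dec Q) (r : Dec R) → ⟦ p ⟧ + ⟦ q ⟧ ≤ ⟦ r ⟧
⟦⟧-+-≤ P⇒R Q⇒R P#Q (no _)  q r = ⟦⟧-mono Q⇒R q r
⟦⟧-+-≤ P⇒R Q⇒R P#Q (yes x) q r =
  ℕ.≤-reflexive (trans (cong suc (⟦⟧-no q (P#Q x))) (sym (⟦⟧-yes r (P⇒R x))))

⟦⟧-×-cong : ∀ {A B : Set} → (A × B) ⇔ (P × Q × R) →
             (a : Dec A) (b : Dec B) (p : Dec P) (q : Dec Q) (r : Dec R) →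
             ⟦ a ⟧ * ⟦ b ⟧ ≡ ⟦ p ⟧ * (⟦ q ⟧ * ⟦ r ⟧)
⟦⟧-×-cong AB⇔PQR a b p q r = trans (sym (⟦⟧-× a b)) (trans
  (⟦⟧-cong AB⇔PQR (a ×-dec b) (p ×-dec (q ×-dec r)))
  (trans (⟦⟧-× p (q ×-dec r)) (cong (⟦ p ⟧ *_) (⟦⟧-× q r))))

∑-cong : ∀ (xs : List A) {f g} → (∀ x → f x ≡ g x) → ∑ xs f ≡ ∑ xs g
∑-cong xs f≗g = cong sum (map-cong f≗g xs)

∑-mono : ∀ (xs : List A) {f g} → (∀ x → f x ≤ g x) → ∑ xs f ≤ ∑ xs g
∑-mono []       f≤g = z≤n
∑-mono (x ∷ xs) f≤g = ℕ.+-mono-≤ (f≤g x) (∑-mono xs f≤g)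

∑-++ : ∀ (xs ys : List A) f → ∑ (xs ++ ys) f ≡ ∑ xs f + ∑ ys f
∑-++ xs ys f = trans (cong sum (map-++ f xs ys)) (sum-++ (map f xs) (map f ys))

∑-map : ∀ (g : A → B) xs f → ∑ (map g xs) f ≡ ∑ xs (f ∘ g)
∑-map g xs f = cong sum (sym (map-∘ xs))

∑-+ : ∀ (xs : List A) f g → ∑ xs (λ x → f x + g x) ≡ ∑ xs f + ∑ xs g
∑-+ []       f g = refl
∑-+ (x ∷ xs) f g = trans (cong (f x + g x +_) (∑-+ xs f g)) (interchange (f x) (g x) _ _)
  where
  interchange : ∀ a b c d → (a + b) + (c + d) ≡ (a + c) + (b + d)
  interchange = solve-∀

*-∑ : ∀ c (xs : List A) f → c * ∑ xs f ≡ ∑ xs (λ x → c * f x)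
*-∑ c []       f = ℕ.*-zeroʳ c
*-∑ c (x ∷ xs) f = trans (ℕ.*-distribˡ-+ c (f x) _) (cong (c * f x +_) (*-∑ c xs f))

∑-0 : ∀ (xs : List A) → ∑ xs (λ _ → 0) ≡ 0
∑-0 []       = refl
∑-0 (_ ∷ xs) = ∑-0 xs

∑-swap : ∀ (xs : List A) (ys : List B) (f : A → B → ℕ) →
         ∑ xs (λ x → ∑ ys (f x)) ≡ ∑ ys (λ y → ∑ xs (λ x → f x y))
∑-swap []       ys f = sym (∑-0 ys)
∑-swap (x ∷ xs) ys f =
  trans (cong (∑ ys (f x) +_) (∑-swap xs ys f)) (sym (∑-+ ys (f x) _))

∑-filter : ∀ {P : Pred A _} (P? : Decidable P) xs f →
           ∑ (filter P? xs) f ≡ ∑ xs (λ x → ⟦ P? x ⟧ * f x)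
∑-filter P? []       f = refl
∑-filter P? (x ∷ xs) f with does (P? x)
... | true  = cong₂ _+_ (sym (ℕ.+-identityʳ (f x))) (∑-filter P? xs f)
... | false = ∑-filter P? xs f

∑-cartesianProductWith : ∀ {C : Set} (_∙_ : A → B → C) xs ys f →
  ∑ (cartesianProductWith _∙_ xs ys) f ≡ ∑ xs (λ x → ∑ ys (λ y → f (x ∙ y)))
∑-cartesianProductWith _∙_ []       ys f = refl
∑-cartesianProductWith _∙_ (x ∷ xs) ys f =
  trans (∑-++ (map (x ∙_) ys) _ f)
        (cong₂ _+_ (∑-map (x ∙_) ys f) (∑-cartesianProductWith _∙_ xs ys f))

-- At most the term `a = c` survives, and it occurs exactly if `c < k`. This is how the range
-- `0 ≤ l < k` of the splittings becomes a condition on set sizes. The induction removes the last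
-- entry, the only one in which `upTo (suc k)` differs from `upTo k`.
∑-upTo-≡ : ∀ k c (ψ : ℕ → ℕ) → ∑ (upTo k) (λ a → ⟦ c ℕ.≟ a ⟧ * ψ a) ≡ ⟦ c ℕ.<? k ⟧ * ψ c
∑-upTo-≡ zero    c ψ = refl
∑-upTo-≡ (suc k) c ψ = begin
  ∑ (upTo (suc k)) h                        ≡⟨ cong (λ xs → ∑ xs h) (upTo-∷ʳ k) ⟨
  ∑ (upTo k ∷ʳ k) h                         ≡⟨ ∑-++ (upTo k) _ h ⟩
  ∑ (upTo k) h + (h k + 0)                  ≡⟨ cong₂ _+_ (∑-upTo-≡ k c ψ) (ℕ.+-identityʳ (h k)) ⟩
  ⟦ c ℕ.<? k ⟧ * ψ c + ⟦ c ℕ.≟ k ⟧ * ψ k    ≡⟨ step (c ℕ.≟ k) ⟩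
  ⟦ c ℕ.<? suc k ⟧ * ψ c                    ∎
  where
  open ≡-Reasoning
  h : ℕ → ℕ
  h a = ⟦ c ℕ.≟ a ⟧ * ψ a
  step : (d : Dec (c ≡ k)) → ⟦ c ℕ.<? k ⟧ * ψ c + ⟦ d ⟧ * ψ k ≡ ⟦ c ℕ.<? suc k ⟧ * ψ c
  step (yes refl) rewrite ⟦⟧-no (c ℕ.<? c) (ℕ.<-irrefl refl) | ⟦⟧-yes (c ℕ.<? suc c) ℕ.≤-refl = refl
  step (no c≢k)   = trans (ℕ.+-identityʳ _) (cong (_* ψ c)
    (⟦⟧-cong (mk⇔ ℕ.m<n⇒m<1+n (λ c≤k → ℕ.≤∧≢⇒< (s≤s⁻¹ c≤k) c≢k)) (c ℕ.<? k) (c ℕ.<? suc k)))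

length-filter : ∀ {A : Set} {P : Pred A _} (P? : Decidable P) xs →
                length (filter P? xs) ≡ ∑ xs (λ x → ⟦ P? x ⟧)
length-filter P? []       = refl
length-filter P? (x ∷ xs) with P? x
... | yes _ = cong suc (length-filter P? xs)
... | no _  = length-filter P? xs

∑-unique : ∀ {A : Set} (_≟_ : DecidableEquality A) {e xs} → Unique xs → e ∈ˡ xs →
           ∑ xs (λ x → ⟦ x ≟ e ⟧) ≡ 1
∑-unique _≟_ {e} {xs = x ∷ xs} (x≢xs ∷ xs!) (here refl) =
  cong₂ _+_ (⟦⟧-yes (x ≟ x) refl) (none x≢xs)
  where
  none : ∀ {ys} → All (e ≢_) ys → ∑ ys (λ y → ⟦ y ≟ e ⟧) ≡ 0
  none []                    = refl
  none {y ∷ ys} (e≢y ∷ e≢ys) = cong₂ _+_ (⟦⟧-no (y ≟ e) (e≢y ∘ sym)) (none e≢ys)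
∑-unique _≟_ {e} {xs = x ∷ xs} (x≢xs ∷ xs!) (there e∈) =
  cong₂ _+_ (⟦⟧-no (x ≟ e) (All.lookup x≢xs e∈)) (∑-unique _≟_ xs! e∈)

∣∣-∑ : ∀ {m} (X : Subset m) → ∣ X ∣ ≡ ∑ (allFin m) (λ v → ⟦ v ∈? X ⟧)
∣∣-∑ []      = refl
∣∣-∑ {suc m} (b ∷ X) = trans (head b) (cong (⟦ zero ∈? (b ∷ X) ⟧ +_) tail)
  where
  head : ∀ b → ∣ b ∷ X ∣ ≡ ⟦ zero ∈? (b ∷ X) ⟧ + ∣ X ∣
  head inside  = refl
  head outside = refl
  open ≡-Reasoning
  f : Fin (suc m) → ℕ
  f v = ⟦ v ∈? (b ∷ X) ⟧
  tail : ∣ X ∣ ≡ ∑ (tabulate suc) f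
  tail = begin
    ∣ X ∣                               ≡⟨ ∣∣-∑ X ⟩
    ∑ (allFin m) (λ v → ⟦ v ∈? X ⟧)     ≡⟨ ∑-cong (allFin m) (λ v → ⟦⟧-cong (mk⇔ there drop-there) (v ∈? X) (suc v ∈? (b ∷ X))) ⟩
    ∑ (allFin m) (f ∘ suc)              ≡⟨ ∑-map suc (allFin m) f ⟨
    ∑ (map suc (allFin m)) f            ≡⟨ cong (λ xs → ∑ xs f) (map-tabulate {n = m} (λ i → i) suc) ⟩
    ∑ (tabulate suc) f                  ∎

-- Sums over powersets

-- Recursive in `X`, unlike a filtered `subsets m`, so that sums over the subsets of different sets
-- can be compared coordinate by coordinate.
powerset : Subset m → List (Subset m)
powerset []            = [] ∷ []
powerset (inside  ∷ X) = map (inside ∷_) (powerset X) ++ map (outside ∷_) (powerset X)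
powerset (outside ∷ X) = map (outside ∷_) (powerset X)

∑-inside : ∀ (X : Subset m) f →
  ∑ (powerset (inside ∷ X)) f ≡ ∑ (powerset X) (f ∘ (inside ∷_)) + ∑ (powerset X) (f ∘ (outside ∷_))
∑-inside X f = trans (∑-++ (map (inside ∷_) (powerset X)) _ f)
                     (cong₂ _+_ (∑-map (inside ∷_) (powerset X) f) (∑-map (outside ∷_) (powerset X) f))

∑-outside : ∀ (X : Subset m) f → ∑ (powerset (outside ∷ X)) f ≡ ∑ (powerset X) (f ∘ (outside ∷_))
∑-outside X f = ∑-map (outside ∷_) (powerset X) f

∑-powerset-cong : ∀ (X : Subset m) {f g} → (∀ S → S ⊆ X → f S ≡ g S) →
                  ∑ (powerset X) f ≡ ∑ (powerset X) g
∑-powerset-cong []            f≗g = cong (_+ 0) (f≗g [] (λ ()))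
∑-powerset-cong (inside ∷ X)  {f} {g} f≗g =
  trans (∑-inside X f) (trans
    (cong₂ _+_ (∑-powerset-cong X (λ S S⊆X → f≗g _ (s⊆s S⊆X)))
               (∑-powerset-cong X (λ S S⊆X → f≗g _ (out⊆ S⊆X))))
    (sym (∑-inside X g)))
∑-powerset-cong (outside ∷ X) {f} {g} f≗g =
  trans (∑-outside X f) (trans
    (∑-powerset-cong X (λ S S⊆X → f≗g _ (out⊆ S⊆X)))
    (sym (∑-outside X g)))

∑-subsets : ∀ {m} (X : Subset m) f → ∑ (subsets m) (λ S → ⟦ S ⊆? X ⟧ * f S) ≡ ∑ (powerset X) f
∑-subsets []      f = cong (_+ 0) (ℕ.*-identityˡ (f []))
∑-subsets {suc m} (b ∷ X) f = begin
  ∑ (subsets (suc m)) h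
    ≡⟨ ∑-cartesianProductWith _∷_ (inside ∷ outside ∷ []) (subsets m) h ⟩
  ∑ (subsets m) (h ∘ (inside ∷_)) + (∑ (subsets m) (h ∘ (outside ∷_)) + 0)
    ≡⟨ cong₂ _+_ (in-part b) (trans (ℕ.+-identityʳ _) out-part) ⟩
  in-sum b + ∑ (powerset X) (f ∘ (outside ∷_))
    ≡⟨ join b ⟩
  ∑ (powerset (b ∷ X)) f ∎
  where
  open ≡-Reasoning
  h : Subset (suc m) → ℕ
  h S = ⟦ S ⊆? (b ∷ X) ⟧ * f S
  in-sum : ∀ b → ℕ
  in-sum inside  = ∑ (powerset X) (f ∘ (inside ∷_))
  in-sum outside = 0
  in-part : ∀ b → ∑ (subsets m) (λ S → ⟦ (inside ∷ S) ⊆? (b ∷ X) ⟧ * f (inside ∷ S)) ≡ in-sum b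
  in-part inside  = trans
    (∑-cong (subsets m) λ S → cong (_* f (inside ∷ S))
      (⟦⟧-cong (mk⇔ drop-∷-⊆ in⊆in) ((inside ∷ S) ⊆? (inside ∷ X)) (S ⊆? X)))
    (∑-subsets X (f ∘ (inside ∷_)))
  in-part outside = ∑-0 (subsets m)
  out-part : ∑ (subsets m) (h ∘ (outside ∷_)) ≡ ∑ (powerset X) (f ∘ (outside ∷_))
  out-part = trans
    (∑-cong (subsets m) λ S → cong (_* f (outside ∷ S))
      (⟦⟧-cong (mk⇔ drop-∷-⊆ out⊆) ((outside ∷ S) ⊆? (b ∷ X)) (S ⊆? X)))
    (∑-subsets X (f ∘ (outside ∷_)))
  join : ∀ b → in-sum b + ∑ (powerset X) (f ∘ (outside ∷_)) ≡ ∑ (powerset (b ∷ X)) f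
  join inside  = sym (∑-inside X f)
  join outside = sym (∑-outside X f)

-- Pascal's rule: the two summands for `inside ∷ X` are the subsets with and without the first
-- vertex.
∑-∣∣-C : ∀ (X : Subset m) k → ∑ (powerset X) (λ S → ⟦ ∣ S ∣ ℕ.≟ k ⟧) ≡ ∣ X ∣ C k
∑-∣∣-C []            zero    = refl
∑-∣∣-C []            (suc k) = refl
∑-∣∣-C (outside ∷ X) k       = trans (∑-outside X _) (∑-∣∣-C X k)
∑-∣∣-C (inside ∷ X)  zero    = trans (∑-inside X _) (cong₂ _+_ (∑-0 (powerset X)) (∑-∣∣-C X 0))
∑-∣∣-C (inside ∷ X)  (suc k) = trans (∑-inside X _) (trans
  (cong₂ _+_
    (trans (∑-cong (powerset X) λ S →
             ⟦⟧-cong (mk⇔ ℕ.suc-injective (cong suc)) (suc ∣ S ∣ ℕ.≟ suc k) (∣ S ∣ ℕ.≟ k))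
           (∑-∣∣-C X k))
    (∑-∣∣-C X (suc k)))
  (nCk+nC[k+1]≡[n+1]C[k+1] ∣ X ∣ k))

-- Disjoint unions and sizes of traces

Disjoint : Subset m → Subset m → Set
Disjoint X Y = ∀ x → x ∈ X → x ∉ Y

disjoint-tail : ∀ {a b} {X Y : Subset m} → Disjoint (a ∷ X) (b ∷ Y) → Disjoint X Y
disjoint-tail X#Y x x∈X x∈Y = X#Y (suc x) (there x∈X) (there x∈Y)

-- A subset of a disjoint union is the same as a pair of traces. The function `f` takes the two
-- traces separately and is arbitrary, so that a coordinate already decided can be absorbed into it
-- in the recursive call.
∑-powerset-∪ : ∀ (X Y : Subset m) → Disjoint X Y → ∀ (f : Subset m → Subset m → ℕ) →
  ∑ (powerset (X ∪ Y)) (λ S → f (S ∩ X) (S ∩ Y)) ≡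
  ∑ (powerset X) (λ A → ∑ (powerset Y) (f A))
∑-powerset-∪ []            []            X#Y f = sym (ℕ.+-identityʳ _)
∑-powerset-∪ (inside ∷ X)  (inside ∷ Y)  X#Y f = contradiction here (X#Y zero here)
∑-powerset-∪ (outside ∷ X) (outside ∷ Y) X#Y f =
  trans (∑-outside (X ∪ Y) _) (trans
    (∑-powerset-∪ X Y (disjoint-tail X#Y) _)
    (sym (trans (∑-outside X _) (∑-cong (powerset X) λ A → ∑-outside Y _))))
∑-powerset-∪ (inside ∷ X)  (outside ∷ Y) X#Y f =
  trans (∑-inside (X ∪ Y) _) (trans
    (cong₂ _+_ (∑-powerset-∪ X Y (disjoint-tail X#Y) _) (∑-powerset-∪ X Y (disjoint-tail X#Y) _))
    (sym (trans (∑-inside X _) (cong₂ _+_ (∑-cong (powerset X) λ A → ∑-outside Y _)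
                                           (∑-cong (powerset X) λ A → ∑-outside Y _)))))
∑-powerset-∪ (outside ∷ X) (inside ∷ Y)  X#Y f =
  trans (∑-inside (X ∪ Y) _) (trans
    (cong₂ _+_ (∑-powerset-∪ X Y (disjoint-tail X#Y) (λ A B → f (outside ∷ A) (inside ∷ B)))
               (∑-powerset-∪ X Y (disjoint-tail X#Y) (λ A B → f (outside ∷ A) (outside ∷ B))))
    (sym (trans (∑-outside X _) (trans (∑-cong (powerset X) λ A → ∑-inside Y _) (∑-+ (powerset X) _ _)))))

∣∣-split : ∀ (X Y S : Subset m) → Disjoint X Y → S ⊆ X ∪ Y → ∣ S ∣ ≡ ∣ S ∩ X ∣ + ∣ S ∩ Y ∣
∣∣-split []            []            []            X#Y S⊆ = refl
∣∣-split (inside ∷ X)  (inside ∷ Y)  (s ∷ S)       X#Y S⊆ = contradiction here (X#Y zero here)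
∣∣-split (outside ∷ X) (outside ∷ Y) (inside ∷ S)  X#Y S⊆ with () ← S⊆ here
∣∣-split (inside ∷ X)  (outside ∷ Y) (inside ∷ S)  X#Y S⊆ =
  cong suc (∣∣-split X Y S (disjoint-tail X#Y) (drop-∷-⊆ S⊆))
∣∣-split (outside ∷ X) (inside ∷ Y)  (inside ∷ S)  X#Y S⊆ =
  trans (cong suc (∣∣-split X Y S (disjoint-tail X#Y) (drop-∷-⊆ S⊆))) (sym (ℕ.+-suc _ _))
∣∣-split (x ∷ X)       (y ∷ Y)       (outside ∷ S) X#Y S⊆ =
  ∣∣-split X Y S (disjoint-tail X#Y) (drop-∷-⊆ S⊆)

-- The indicator that every listed set meets `S` in fewer than `k` elements. It is a product so that
-- it factors when one set is split off, and its bound is that of the entries of a splitting. For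
-- `S` of size `k` it says that no listed set contains `S`; see `spread-⊈`.
spread : ℕ → List (Subset m) → Subset m → ℕ
spread k []       S = 1
spread k (X ∷ Xs) S = ⟦ ∣ S ∩ X ∣ ℕ.<? k ⟧ * spread k Xs S

∩-absorb : ∀ (S X U : Subset m) → X ⊆ U → (S ∩ U) ∩ X ≡ S ∩ X
∩-absorb S X U X⊆U = ⊆-antisym
  (λ x∈ → let y , z = x∈p∩q⁻ (S ∩ U) X x∈ in x∈p∩q⁺ (proj₁ (x∈p∩q⁻ S U y) , z))
  (λ x∈ → let y , z = x∈p∩q⁻ S X x∈ in x∈p∩q⁺ (x∈p∩q⁺ (y , X⊆U z) , z))

spread-∩ : ∀ k (Xs : List (Subset m)) {U} S → All (_⊆ U) Xs → spread k Xs (S ∩ U) ≡ spread k Xs S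
spread-∩ k []       S []              = refl
spread-∩ k (X ∷ Xs) {U} S (X⊆U ∷ Xs⊆U) =
  cong₂ _*_ (cong (λ T → ⟦ ∣ T ∣ ℕ.<? k ⟧) (∩-absorb S X U X⊆U)) (spread-∩ k Xs S Xs⊆U)

⊆-⋃ : ∀ (Xs : List (Subset m)) → All (_⊆ ⋃ Xs) Xs
⊆-⋃ []       = []
⊆-⋃ (X ∷ Xs) = p⊆p∪q (⋃ Xs) ∷ All.map (λ Y⊆ {x} x∈Y → q⊆p∪q X (⋃ Xs) (Y⊆ x∈Y)) (⊆-⋃ Xs)

disjoint-⋃ : ∀ {X : Subset m} {Xs} → All (Disjoint X) Xs → Disjoint X (⋃ Xs)
disjoint-⋃ []                         x x∈X x∈⊥ = ∉⊥ x∈⊥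
disjoint-⋃ {Xs = Y ∷ Xs} (X#Y ∷ X#Xs) x x∈X x∈  with x∈p∪q⁻ Y (⋃ Xs) x∈
... | inj₁ x∈Y = X#Y x x∈X x∈Y
... | inj₂ x∈⋃ = disjoint-⋃ X#Xs x x∈X x∈⋃

choices : ∀ (Xs : List (Subset m)) → Vec ℕ (length Xs) → ℕ
choices Xs l = Vec.foldr′ _*_ 1 (Vec.zipWith _C_ (Vec.map ∣_∣ (Vec.fromList Xs)) l)

-- Subsets are grouped by the vector of their trace sizes; a vector `l` belongs to a product of
-- binomial coefficients many subsets. Once the trace `A` on the first set is fixed, the induction
-- hypothesis is applied to the weight `φ (∣ A ∣ + _)`.
∑-spread : ∀ k (Xs : List (Subset m)) → AllPairs Disjoint Xs → ∀ φ →
  ∑ (powerset (⋃ Xs)) (λ S → spread k Xs S * φ ∣ S ∣) ≡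
  ∑ (vectors (upTo k) (length Xs)) (λ l → φ (Vec.sum l) * choices Xs l)
∑-spread {m} k [] [] φ = trans
  (∑-powerset-cong (⊥ {m}) λ S S⊆⊥ →
    trans (ℕ.+-identityʳ _) (cong φ (ℕ.n≤0⇒n≡0 (subst (∣ S ∣ ≤_) (∣⊥∣≡0 m) (p⊆q⇒∣p∣≤∣q∣ S⊆⊥)))))
  (∑-⊥ m)
  where
  ∑-⊥ : ∀ m → ∑ (powerset (⊥ {m})) (λ _ → φ 0) ≡ φ 0 * 1 + 0
  ∑-⊥ zero    = cong (_+ 0) (sym (ℕ.*-identityʳ _))
  ∑-⊥ (suc m) = trans (∑-outside (⊥ {m}) _) (∑-⊥ m)
∑-spread k (X ∷ Xs) (X#Xs ∷ Xs#) φ = begin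
  ∑ (powerset (X ∪ ⋃ Xs)) (λ S → spread k (X ∷ Xs) S * φ ∣ S ∣)
    ≡⟨ ∑-powerset-cong (X ∪ ⋃ Xs) (λ S S⊆ → cong₂ _*_
         (cong (⟦ ∣ S ∩ X ∣ ℕ.<? k ⟧ *_) (sym (spread-∩ k Xs S (⊆-⋃ Xs))))
         (cong φ (∣∣-split X (⋃ Xs) S X#⋃ S⊆))) ⟩
  ∑ (powerset (X ∪ ⋃ Xs)) (λ S → f (S ∩ X) (S ∩ ⋃ Xs))
    ≡⟨ ∑-powerset-∪ X (⋃ Xs) X#⋃ f ⟩
  ∑ (powerset X) (λ A → ∑ (powerset (⋃ Xs)) (f A))
    ≡⟨ ∑-cong (powerset X) inner ⟩
  ∑ (powerset X) (λ A → ⟦ ∣ A ∣ ℕ.<? k ⟧ * ψ ∣ A ∣)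
    -- The condition `∣ A ∣ < k` is expanded into a sum over the possible sizes `a`, so that after
    -- the exchange the sets `A` of size `a` can be counted by a binomial coefficient.
    ≡⟨ ∑-cong (powerset X) (λ A → sym (∑-upTo-≡ k ∣ A ∣ ψ)) ⟩
  ∑ (powerset X) (λ A → ∑ (upTo k) (λ a → ⟦ ∣ A ∣ ℕ.≟ a ⟧ * ψ a))
    ≡⟨ ∑-swap (powerset X) (upTo k) _ ⟩
  ∑ (upTo k) (λ a → ∑ (powerset X) (λ A → ⟦ ∣ A ∣ ℕ.≟ a ⟧ * ψ a))
    ≡⟨ ∑-cong (upTo k) outer ⟩
  ∑ (upTo k) (λ a → ∑ vs (λ l → φ (a + Vec.sum l) * ((∣ X ∣ C a) * choices Xs l)))
    ≡⟨ ∑-cartesianProductWith _∷_ (upTo k) vs _ ⟨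
  ∑ (vectors (upTo k) (length (X ∷ Xs))) (λ l → φ (Vec.sum l) * choices (X ∷ Xs) l) ∎
  where
  open ≡-Reasoning
  X#⋃ : Disjoint X (⋃ Xs)
  X#⋃ = disjoint-⋃ X#Xs
  vs : List (Vec ℕ (length Xs))
  vs = vectors (upTo k) (length Xs)
  f : Subset _ → Subset _ → ℕ
  f A B = ⟦ ∣ A ∣ ℕ.<? k ⟧ * spread k Xs B * φ (∣ A ∣ + ∣ B ∣)
  ψ : ℕ → ℕ
  ψ a = ∑ vs (λ l → φ (a + Vec.sum l) * choices Xs l)
  inner : ∀ A → ∑ (powerset (⋃ Xs)) (f A) ≡ ⟦ ∣ A ∣ ℕ.<? k ⟧ * ψ ∣ A ∣
  inner A = begin
    ∑ (powerset (⋃ Xs)) (f A)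
      ≡⟨ ∑-cong (powerset (⋃ Xs)) (λ B → ℕ.*-assoc ⟦ ∣ A ∣ ℕ.<? k ⟧ (spread k Xs B) _) ⟩
    ∑ (powerset (⋃ Xs)) (λ B → ⟦ ∣ A ∣ ℕ.<? k ⟧ * (spread k Xs B * φ (∣ A ∣ + ∣ B ∣)))
      ≡⟨ *-∑ ⟦ ∣ A ∣ ℕ.<? k ⟧ (powerset (⋃ Xs)) _ ⟨
    ⟦ ∣ A ∣ ℕ.<? k ⟧ * ∑ (powerset (⋃ Xs)) (λ B → spread k Xs B * φ (∣ A ∣ + ∣ B ∣))
      ≡⟨ cong (⟦ ∣ A ∣ ℕ.<? k ⟧ *_) (∑-spread k Xs Xs# (λ b → φ (∣ A ∣ + b))) ⟩
    ⟦ ∣ A ∣ ℕ.<? k ⟧ * ψ ∣ A ∣ ∎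
  rearrange : ∀ p c q → c * (p * q) ≡ p * (c * q)
  rearrange = solve-∀
  outer : ∀ a → ∑ (powerset X) (λ A → ⟦ ∣ A ∣ ℕ.≟ a ⟧ * ψ a) ≡
                ∑ vs (λ l → φ (a + Vec.sum l) * ((∣ X ∣ C a) * choices Xs l))
  outer a = begin
    ∑ (powerset X) (λ A → ⟦ ∣ A ∣ ℕ.≟ a ⟧ * ψ a)
      ≡⟨ ∑-cong (powerset X) (λ A → ℕ.*-comm ⟦ ∣ A ∣ ℕ.≟ a ⟧ (ψ a)) ⟩
    ∑ (powerset X) (λ A → ψ a * ⟦ ∣ A ∣ ℕ.≟ a ⟧)
      ≡⟨ *-∑ (ψ a) (powerset X) _ ⟨
    ψ a * ∑ (powerset X) (λ A → ⟦ ∣ A ∣ ℕ.≟ a ⟧)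
      ≡⟨ cong (ψ a *_) (∑-∣∣-C X a) ⟩
    ψ a * (∣ X ∣ C a)
      ≡⟨ ℕ.*-comm (ψ a) _ ⟩
    (∣ X ∣ C a) * ψ a
      ≡⟨ *-∑ (∣ X ∣ C a) vs _ ⟩
    ∑ vs (λ l → (∣ X ∣ C a) * (φ (a + Vec.sum l) * choices Xs l))
      ≡⟨ ∑-cong vs (λ l → rearrange (φ (a + Vec.sum l)) (∣ X ∣ C a) (choices Xs l)) ⟩
    ∑ vs (λ l → φ (a + Vec.sum l) * ((∣ X ∣ C a) * choices Xs l)) ∎

-- Subsets of vertices

⁅_∣⁆ : {P : Fin m → Set} → Decidable P → Subset m
⁅ P? ∣⁆ = Vec.tabulate (λ v → does (P? v))

∈⁅∣⁆⁺ : {P : Fin m → Set} (P? : Decidable P) → P v → v ∈ ⁅ P? ∣⁆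
∈⁅∣⁆⁺ {v = v} P? Pv = lookup⇒[]= v _ (trans (lookup∘tabulate _ v) (dec-true (P? v) Pv))

∈⁅∣⁆⁻ : {P : Fin m → Set} (P? : Decidable P) → v ∈ ⁅ P? ∣⁆ → P v
∈⁅∣⁆⁻ {v = v} P? v∈ with P? v | trans (sym (lookup∘tabulate (λ v → does (P? v)) v)) ([]=⇒lookup v∈)
... | yes Pv | _ = Pv

∉-- : ∀ (X : Subset m) v → v ∉ X - v
∉-- (b ∷ X) (suc v) (Vec.there v∈) = ∉-- X v v∈
∉-- (inside  ∷ X) zero ()
∉-- (outside ∷ X) zero ()

⊈⇒∃ : ∀ (X Y : Subset m) → X ⊈ Y → ∃ λ x → x ∈ X × x ∉ Y
⊈⇒∃ X Y X⊈Y with any? (λ x → (x ∈? X) ×-dec ¬? (x ∈? Y))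
... | yes x    = x
... | no  none = contradiction
  (λ {x} x∈X → decidable-stable (x ∈? Y) (λ x∉Y → none (x , x∈X , x∉Y))) X⊈Y

∣∩∣<∣∣ : ∀ (S X : Subset m) → (∣ S ∩ X ∣ < ∣ S ∣) ⇔ (S ⊈ X)
∣∩∣<∣∣ S X = mk⇔
  (λ lt S⊆X → ℕ.<⇒≱ lt (p⊆q⇒∣p∣≤∣q∣ (λ x∈S → x∈p∩q⁺ (x∈S , S⊆X x∈S))))
  (λ S⊈X → let x , x∈S , x∉X = ⊈⇒∃ S X S⊈X in
    p⊂q⇒∣p∣<∣q∣ (p∩q⊆p S X , x , x∈S , x∉X ∘ proj₂ ∘ x∈p∩q⁻ S X))

∣∪⁅⁆∣ : ∀ (X : Subset m) y → y ∉ X → ∣ X ∪ ⁅ y ⁆ ∣ ≡ suc ∣ X ∣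
∣∪⁅⁆∣ (inside ∷ X)  zero    y∉X = contradiction Vec.here y∉X
∣∪⁅⁆∣ (outside ∷ X) zero    y∉X = cong (suc ∘ ∣_∣) (∪-identityʳ X)
∣∪⁅⁆∣ (inside ∷ X)  (suc y) y∉X = cong suc (∣∪⁅⁆∣ X y (y∉X ∘ Vec.there))
∣∪⁅⁆∣ (outside ∷ X) (suc y) y∉X = ∣∪⁅⁆∣ X y (y∉X ∘ Vec.there)

-- Walks and components

Edge : Graph m → Fin m → Fin m → Set
Edge G u v = Graph._~_ G u v

reach-sym : ∀ (G : Graph m) → Reach G u v → Reach G v u
reach-sym G = reverse (Graph.~-sym G)

reach-mono : H ⊑ G → Reach H u v → Reach G u v
reach-mono H⊑G = gmap id (proj₂ H⊑G _ _)

reach-V : ∀ (G : Graph m) → u ∈ V G → Reach G u v → v ∈ V G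
reach-V G u∈ ε        = u∈
reach-V G u∈ (e ◅ es) = reach-V G (Graph.~-vertex G (Graph.~-sym G e)) es

reach-closed : ∀ (G : Graph m) X →
  ¬ (∃ λ x → ∃ λ y → x ∈ X × y ∉ X × Edge G x y) → x ∈ X → Reach G x y → y ∈ X
reach-closed G X none x∈X ε = x∈X
reach-closed G X none x∈X (_◅_ {j = j} e es) = reach-closed G X none
  (decidable-stable (j ∈? X) (λ j∉X → none (_ , j , x∈X , j∉X , e))) es

∖-V⁺ : ∀ (G : Graph m) → x ∈ V G → x ≢ v → x ∈ V (G ∖ v)
∖-V⁺ G x∈ x≢v = x∈p∩q⁺ (x∈ , x∈p∧x≢y⇒x∈p-y x∈ x≢v)

∖-V⁻ : ∀ (G : Graph m) v → x ∈ V (G ∖ v) → x ∈ V G × x ≢ v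
∖-V⁻ G v x∈ with x∈p∩q⁻ (V G) (V G - v) x∈
... | x∈V , x∈- = x∈V , λ { refl → ∉-- (V G) v x∈- }

∖-~⁺ : ∀ (G : Graph m) → Edge G x y → x ≢ v → y ≢ v → Edge (G ∖ v) x y
∖-~⁺ G e x≢v y≢v = e , x∈p∧x≢y⇒x∈p-y (~-vertex e) x≢v , x∈p∧x≢y⇒x∈p-y (~-vertex (~-sym e)) y≢v
  where open Graph G

∖-⊑ : ∀ (G : Graph m) v → G ∖ v ⊑ G
∖-⊑ G v = (proj₁ ∘ ∖-V⁻ G v) , λ _ _ → proj₁

induced-⊑ : ∀ (G : Graph m) X → induced G X ⊑ G
induced-⊑ G X = p∩q⊆p (V G) X , λ _ _ → proj₁

component : ∀ (G : Graph m) → Fin m → Subset m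
component G u = ⁅ reach? G u ∣⁆

component-isComponent : ∀ (G : Graph m) → u ∈ V G → IsComponent G (component G u)
component-isComponent {u = u} G u∈ = u , u∈ , λ v → ∈⁅∣⁆⁻ (reach? G u) , ∈⁅∣⁆⁺ (reach? G u)

component-∈ : ∀ (G : Graph m) → u ∈ V G → component G u ∈ˡ components G
component-∈ G u∈ = ∈-filter⁺ (isComponent? G) (subsets-complete _) (component-isComponent G u∈)

∈-components⁻ : ∀ (G : Graph m) → X ∈ˡ components G → IsComponent G X
∈-components⁻ {m} G X∈ = proj₂ (∈-filter⁻ (isComponent? G) {xs = subsets m} X∈)

isComponent-reach : ∀ (G : Graph m) → IsComponent G X → x ∈ X → y ∈ X → Reach G x y
isComponent-reach G (_ , _ , X⇔) x∈ y∈ = reach-sym G (proj₁ (X⇔ _) x∈) ◅◅ proj₁ (X⇔ _) y∈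

isComponent-closed : ∀ (G : Graph m) → IsComponent G X → x ∈ X → Reach G x y → y ∈ X
isComponent-closed G (_ , _ , X⇔) x∈ r = proj₂ (X⇔ _) (proj₁ (X⇔ _) x∈ ◅◅ r)

isComponent-unique : ∀ (G : Graph m) {X Y} → IsComponent G X → IsComponent G Y → x ∈ X → x ∈ Y → X ≡ Y
isComponent-unique G cX cY x∈X x∈Y = ⊆-antisym
  (λ y∈X → isComponent-closed G cY x∈Y (isComponent-reach G cX x∈X y∈X))
  (λ y∈Y → isComponent-closed G cX x∈X (isComponent-reach G cY x∈Y y∈Y))

isComponent-⊆ : ∀ (G : Graph m) → IsComponent G X → X ⊆ V G
isComponent-⊆ G (_ , u∈ , X⇔) x∈ = reach-V G u∈ (proj₁ (X⇔ _) x∈)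

vectors-unique : ∀ {A : Set} {xs : List A} → Unique xs → ∀ n → Unique (vectors xs n)
vectors-unique xs! zero    = [] ∷ []
vectors-unique xs! (suc n) = Unique.cartesianProductWith⁺ _∷_ ∷-injective xs! (vectors-unique xs! n)

components-unique : ∀ (G : Graph m) → Unique (components G)
components-unique {m} G = Unique.filter⁺ (isComponent? G)
  (vectors-unique (((λ ()) ∷ []) ∷ [] ∷ []) m)

components-disjoint : ∀ (G : Graph m) → AllPairs Disjoint (components G)
components-disjoint {m} G = go (all-filter (isComponent? G) (subsets m)) (components-unique G)
  where
  go : ∀ {Xs} → All (IsComponent G) Xs → Unique Xs → AllPairs Disjoint Xs
  go []         []           = []
  go (cX ∷ cXs) (X≢Xs ∷ Xs!) =
    All.zipWith (λ (cY , X≢Y) x x∈X x∈Y → X≢Y (isComponent-unique G cX cY x∈X x∈Y)) (cXs , X≢Xs)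
    ∷ go cXs Xs!

⋃-components : ∀ (G : Graph m) → ⋃ (components G) ≡ V G
⋃-components {m} G = ⊆-antisym
  (⋃-⊆ (all-filter (isComponent? G) (subsets m)))
  (λ {x} x∈ → All.lookup (⊆-⋃ (components G)) (component-∈ G x∈) (∈⁅∣⁆⁺ (reach? G x) ε))
  where
  ⋃-⊆ : ∀ {Xs} → All (IsComponent G) Xs → ⋃ Xs ⊆ V G
  ⋃-⊆ []                       x∈ = contradiction x∈ ∉⊥
  ⋃-⊆ {Xs = X ∷ Xs} (cX ∷ cXs) x∈ with x∈p∪q⁻ X (⋃ Xs) x∈
  ... | inj₁ x∈X = isComponent-⊆ G cX x∈X
  ... | inj₂ x∈⋃ = ⋃-⊆ cXs x∈⋃

length≤1 : ∀ {A : Set} {xs : List A} → Unique xs → (∀ {x y} → x ∈ˡ xs → y ∈ˡ xs → x ≡ y) → length xs ≤ 1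
length≤1 []                      all≡ = z≤n
length≤1 (_ ∷ [])                all≡ = s≤s z≤n
length≤1 ((x≢y ∷ _) ∷ _ ∷ _) all≡ = contradiction (all≡ (here refl) (there (here refl))) x≢y

1≤length : ∀ {A : Set} {x : A} {xs} → x ∈ˡ xs → 1 ≤ length xs
1≤length (here _)  = s≤s z≤n
1≤length (there _) = s≤s z≤n

2≤length : ∀ {A : Set} {x y : A} {xs} → x ∈ˡ xs → y ∈ˡ xs → x ≢ y → 2 ≤ length xs
2≤length (here refl) (here refl) x≢y = contradiction refl x≢y
2≤length (here _)    (there y∈)  x≢y = s≤s (1≤length y∈)
2≤length (there x∈)  _           x≢y = s≤s (1≤length x∈)

length-components≤1 : ∀ (G : Graph m) → (∀ u v → u ∈ V G → v ∈ V G → Reach G u v) →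
                      length (components G) ≤ 1
length-components≤1 G reach = length≤1 (components-unique G) λ X∈ Y∈ →
  let cX@(u , u∈ , X⇔) = ∈-components⁻ G X∈
      cY@(v , v∈ , Y⇔) = ∈-components⁻ G Y∈
  in isComponent-unique G cX cY (proj₂ (X⇔ u) ε) (proj₂ (Y⇔ u) (reach v u v∈ u∈))

-- Deleting `v` leaves at most one component, while `G` has at least one, that of `v`; so the number
-- does not grow.
¬cutVertex : ∀ (G : Graph m) v →
  (∀ x y → x ∈ V (G ∖ v) → y ∈ V (G ∖ v) → Reach (G ∖ v) x y) → ¬ CutVertex G v
¬cutVertex G v reach (v∈ , lt) =
  ℕ.<⇒≱ lt (ℕ.≤-trans (length-components≤1 (G ∖ v) reach) (1≤length (component-∈ G v∈)))

-- Sets split by the components of a graph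

Split : Graph m → Subset m → Set
Split H S = S ⊆ V H × All (S ⊈_) (components H)

Split? : ∀ (H : Graph m) S → Dec (Split H S)
Split? H S = (S ⊆? V H) ×-dec All.all? (λ X → ¬? (S ⊆? X)) (components H)

-- Some `t` in `S` lies outside the component of `s`, which gives two components after the deletion,
-- against at most one in `G`. Nonemptiness excludes a vacuous split: if the deletion leaves no
-- vertices, there are no components, and the empty set counts as split.
split⇒cutVertex : ∀ (G : Graph m) → Connected G → v ∈ V G → Nonempty S → Split (G ∖ v) S → CutVertex G v
split⇒cutVertex {v = v} {S} G (_ , reach) v∈ (s , s∈S) (S⊆ , S⊈) =
  v∈ , ℕ.≤-trans (s≤s (length-components≤1 G reach))
                 (2≤length (component-∈ (G ∖ v) (S⊆ s∈S)) (component-∈ (G ∖ v) (S⊆ t∈S)) distinct)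
  where
  r? : ∀ u → Decidable (Reach (G ∖ v) u)
  r? = reach? (G ∖ v)
  far : ∃ λ t → t ∈ S × t ∉ component (G ∖ v) s
  far = ⊈⇒∃ S _ (All.lookup S⊈ (component-∈ (G ∖ v) (S⊆ s∈S)))
  t : Fin _
  t = proj₁ far
  t∈S : t ∈ S
  t∈S = proj₁ (proj₂ far)
  distinct : component (G ∖ v) s ≢ component (G ∖ v) t
  distinct eq = proj₂ (proj₂ far) (subst (t ∈_) (sym eq) (∈⁅∣⁆⁺ (r? t) ε))

spread-⊈ : ∀ (Xs : List (Subset m)) S → spread ∣ S ∣ Xs S ≡ ⟦ All.all? (λ X → ¬? (S ⊆? X)) Xs ⟧
spread-⊈ []       S = refl
spread-⊈ (X ∷ Xs) S = trans
  (cong₂ _*_ (⟦⟧-cong (∣∩∣<∣∣ S X) (∣ S ∩ X ∣ ℕ.<? ∣ S ∣) (¬? (S ⊆? X))) (spread-⊈ Xs S))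
  (sym (⟦⟧-× (¬? (S ⊆? X)) (All.all? (λ X → ¬? (S ⊆? X)) Xs)))

-- The weight `⟦ j ℕ.≟ k ⟧` in `∑-spread` is the filter in `splittings`, which turns the sum of
-- products of binomial coefficients into a count of `k`-sets.
N-split : ∀ k (H : Graph m) → N k H ≡ ∑ (subsets m) (λ S → ⟦ Split? H S ⟧ * ⟦ ∣ S ∣ ℕ.≟ k ⟧)
N-split {m} k H = begin
  ∑ (splittings (length Xs) k) (choices Xs)
    ≡⟨ ∑-filter (λ l → Vec.sum l ℕ.≟ k) (vectors (upTo k) (length Xs)) (choices Xs) ⟩
  ∑ (vectors (upTo k) (length Xs)) (λ l → ⟦ Vec.sum l ℕ.≟ k ⟧ * choices Xs l)
    ≡⟨ ∑-spread k Xs (components-disjoint H) (λ j → ⟦ j ℕ.≟ k ⟧) ⟨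
  ∑ (powerset (⋃ Xs)) (λ S → spread k Xs S * ⟦ ∣ S ∣ ℕ.≟ k ⟧)
    ≡⟨ cong (λ U → ∑ (powerset U) (λ S → spread k Xs S * ⟦ ∣ S ∣ ℕ.≟ k ⟧)) (⋃-components H) ⟩
  ∑ (powerset (V H)) (λ S → spread k Xs S * ⟦ ∣ S ∣ ℕ.≟ k ⟧)
    ≡⟨ ∑-subsets (V H) _ ⟨
  ∑ (subsets m) (λ S → ⟦ S ⊆? V H ⟧ * (spread k Xs S * ⟦ ∣ S ∣ ℕ.≟ k ⟧))
    ≡⟨ ∑-cong (subsets m) pointwise ⟩
  ∑ (subsets m) (λ S → ⟦ Split? H S ⟧ * ⟦ ∣ S ∣ ℕ.≟ k ⟧) ∎
  where
  open ≡-Reasoning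
  Xs : List (Subset m)
  Xs = components H
  pointwise : ∀ S → ⟦ S ⊆? V H ⟧ * (spread k Xs S * ⟦ ∣ S ∣ ℕ.≟ k ⟧) ≡ ⟦ Split? H S ⟧ * ⟦ ∣ S ∣ ℕ.≟ k ⟧
  pointwise S = trans (sym (ℕ.*-assoc ⟦ S ⊆? V H ⟧ _ _)) (by-size (∣ S ∣ ℕ.≟ k))
    where
    -- `spread k` expresses non-containment only if `S` has size `k`; for other `S` both sides
    -- vanish through their last factor.
    by-size : (d : Dec (∣ S ∣ ≡ k)) → ⟦ S ⊆? V H ⟧ * spread k Xs S * ⟦ d ⟧ ≡ ⟦ Split? H S ⟧ * ⟦ d ⟧
    by-size (no _)     = trans (ℕ.*-zeroʳ (⟦ S ⊆? V H ⟧ * spread k Xs S)) (sym (ℕ.*-zeroʳ ⟦ Split? H S ⟧))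
    by-size (yes refl) = cong (_* 1) (trans
      (cong (⟦ S ⊆? V H ⟧ *_) (spread-⊈ Xs S))
      (sym (⟦⟧-× (S ⊆? V H) (All.all? (λ X → ¬? (S ⊆? X)) Xs))))

-- Cycles in a block graph

-- Paths without repeated vertices, indexed by their vertex set. The set is needed to induce the
-- cycle, and the absence of repetitions to know what remains when a vertex is deleted.
data Path (G : Graph m) : Fin m → Fin m → Subset m → Set where
  [_] : ∀ u → Path G u u ⁅ u ⁆
  _∷⟨_⟩_ : Edge G u v → u ∉ X → Path G v y X → Path G u y (⁅ u ⁆ ∪ X)

path-start : Path G u y X → u ∈ X
path-start [ u ]                      = x∈⁅x⁆ u
path-start (_∷⟨_⟩_ {u = u} {X = X} _ _ _) = p⊆p∪q X (x∈⁅x⁆ u)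

path-end : Path G u y X → y ∈ X
path-end [ u ]                        = x∈⁅x⁆ u
path-end (_∷⟨_⟩_ {u = u} {X = X} _ _ p)   = q⊆p∪q ⁅ u ⁆ X (path-end p)

suffix : Path G v y X → u ∈ X → ∃ (Path G u y)
suffix [ v ] u∈ with x∈⁅y⁆⇒x≡y v u∈
... | refl = ⁅ v ⁆ , [ v ]
suffix p@(_∷⟨_⟩_ {u = x} {X = X} e x∉X q) u∈ with x∈p∪q⁻ ⁅ x ⁆ X u∈
... | inj₂ u∈X = suffix q u∈X
... | inj₁ u∈x with x∈⁅y⁆⇒x≡y x u∈x
...   | refl = _ , p

-- Loop erasure: if the new first vertex already lies on the path, the path is cut down to its part
-- from there on.
reach⇒path : ∀ (G : Graph m) → Reach G u y → ∃ (Path G u y)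
reach⇒path G (ε {x = u}) = ⁅ u ⁆ , [ u ]
reach⇒path {u = u} G (e ◅ es) with reach⇒path G es
... | X , p with u ∈? X
...   | yes u∈X = suffix p u∈X
...   | no  u∉X = _ , e ∷⟨ u∉X ⟩ p

path-V : Path G u y X → y ∈ V G → X ⊆ V G
path-V [ u ] u∈ x∈ with x∈⁅y⁆⇒x≡y u x∈
... | refl = u∈
path-V {G = G} (_∷⟨_⟩_ {u = u} {X = X} e _ p) y∈ x∈ with x∈p∪q⁻ ⁅ u ⁆ X x∈
... | inj₂ x∈X = path-V p y∈ x∈X
... | inj₁ x∈u with x∈⁅y⁆⇒x≡y u x∈u
...   | refl = Graph.~-vertex G e

path-reach-end : Path G u y X → (∀ {p q} → p ∈ X → q ∈ X → Edge G p q → Edge K p q) →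
                 z ∈ X → Reach K z y
path-reach-end {K = K} [ u ] sub z∈ with x∈⁅y⁆⇒x≡y u z∈
... | refl = ε
path-reach-end {K = K} (_∷⟨_⟩_ {u = u} {v = v} {X = X} e _ p) sub z∈ with x∈p∪q⁻ ⁅ u ⁆ X z∈
... | inj₂ z∈X = path-reach-end {K = K} p (λ a b → sub (q⊆p∪q ⁅ u ⁆ X a) (q⊆p∪q ⁅ u ⁆ X b)) z∈X
... | inj₁ z∈u with x∈⁅y⁆⇒x≡y u z∈u
...   | refl = sub (p⊆p∪q X z∈u) (q⊆p∪q ⁅ u ⁆ X (path-start p)) e
               ◅ path-reach-end {K = K} p (λ a b → sub (q⊆p∪q ⁅ u ⁆ X a) (q⊆p∪q ⁅ u ⁆ X b)) (path-start p)

-- Deleting `v` from a path leaves at most two segments, and each of them contains an endpoint of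
-- the path.
path-minus : ∀ {G K : Graph m} → Path G u y X →
  (∀ {p q} → p ∈ X → q ∈ X → p ≢ v → q ≢ v → Edge G p q → Edge K p q) →
  z ∈ X → z ≢ v → (u ≢ v × Reach K z u) ⊎ (y ≢ v × Reach K z y)
path-minus [ u ] sub z∈ z≢v with x∈⁅y⁆⇒x≡y u z∈
... | refl = inj₁ (z≢v , ε)
path-minus {v = v} {G = G} {K} (_∷⟨_⟩_ {u = u} {v = u′} {X = X} e u∉X p) sub z∈ z≢v with x∈p∪q⁻ ⁅ u ⁆ X z∈
... | inj₁ z∈u with x∈⁅y⁆⇒x≡y u z∈u
...   | refl = inj₁ (z≢v , ε)
path-minus {v = v} {G = G} {K} (_∷⟨_⟩_ {u = u} {v = u′} {X = X} e u∉X p) sub z∈ z≢v | inj₂ z∈X with u ≟ᶠ v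
-- The deleted vertex is the first one. It does not recur, so the whole remaining path leads from
-- `z` to `y`.
... | yes refl = inj₂ (≢u (path-end p) ,
        path-reach-end {K = K} p (λ a b → sub (X⊆ a) (X⊆ b) (≢u a) (≢u b)) z∈X)
  where
  X⊆ : X ⊆ ⁅ u ⁆ ∪ X
  X⊆ = q⊆p∪q ⁅ u ⁆ X
  ≢u : ∀ {x} → x ∈ X → x ≢ u
  ≢u x∈X refl = u∉X x∈X
... | no u≢v with path-minus {v = v} {K = K} p (λ a b → sub (q⊆p∪q ⁅ u ⁆ X a) (q⊆p∪q ⁅ u ⁆ X b)) z∈X z≢v
...   | inj₂ end         = inj₂ end
...   | inj₁ (u′≢v , r) = inj₁ (u≢v , r ◅◅
          sub (q⊆p∪q ⁅ u ⁆ X (path-start p)) (p⊆p∪q X (x∈⁅x⁆ u)) u′≢v u≢v (Graph.~-sym G e) ◅ ε)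

-- Nonseparable sets, blocks and the cycle

nonseparable? : ∀ (G : Graph m) → Dec (Nonseparable G)
nonseparable? G = connected? G ×-dec all? (λ v → ¬? (cutVertex? G v))

-- A nonseparable set is enlarged as long as a strictly larger one exists; this ends because there
-- are finitely many vertices.
block-⊇ : ∀ (G : Graph m) B → B ⊆ V G → Nonseparable (induced G B) → ∃ λ B′ → IsBlock G B′ × B ⊆ B′
block-⊇ G B = go B (⊃-wellFounded B)
  where
  go : ∀ B → Acc (λ P Q → Q ⊂ P) B → B ⊆ V G → Nonseparable (induced G B) → ∃ λ B′ → IsBlock G B′ × B ⊆ B′
  go B (acc rec) B⊆V nonsep
    with anySubset? (λ B′ → (B′ ⊆? V G) ×-dec nonseparable? (induced G B′) ×-dec (B ⊂? B′))
  ... | yes (B′ , B′⊆V , nonsep′ , B⊂B′) =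
    let B″ , block , B′⊆B″ = go B′ (rec B⊂B′) B′⊆V nonsep′
    in B″ , block , λ x∈ → B′⊆B″ (proj₁ B⊂B′ x∈)
  ... | no none = B , (B⊆V , nonsep , maximal) , id
    where
    maximal : ∀ B′ → B′ ⊆ V G → Nonseparable (induced G B′) → B ⊆ B′ → B′ ⊆ B
    maximal B′ B′⊆V nonsep′ B⊆B′ {x} x∈B′ = decidable-stable (x ∈? B)
      (λ x∉B → none (B′ , B′⊆V , nonsep′ , B⊆B′ , x , x∈B′ , x∉B))

nonseparable⇒complete : ∀ (G : Graph m) → BlockGraph G → ∀ B → B ⊆ V G →
                        Nonseparable (induced G B) → x ∈ B → y ∈ B → x ≢ y → Edge G x y
nonseparable⇒complete G blockGraph B B⊆V nonsep x∈ y∈ x≢y with block-⊇ G B B⊆V nonsep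
... | B′ , block , B⊆B′ =
  proj₁ (blockGraph B′ block _ _ (x∈p∩q⁺ (B⊆V x∈ , B⊆B′ x∈)) (x∈p∩q⁺ (B⊆V y∈ , B⊆B′ y∈)) x≢y)

-- The path avoids `w`, so its vertices together with `w` form a cycle, or a single edge if `a` and
-- `b` coincide. The graph induced on them may have chords, which only add connections.
module Cycle (G : Graph m) {w a b : Fin m} {I : Subset m}
  (a~w : Edge G a w) (b~w : Edge G b w) (p : Path (G ∖ w) a b I) where

  open Graph G hiding (V)

  ≢w : Edge G x w → x ≢ w
  ≢w e refl = ~-irrefl e

  I⊆ : I ⊆ V (G ∖ w)
  I⊆ = path-V p (∖-V⁺ G (~-vertex b~w) (≢w b~w))

  D : Subset m
  D = I ∪ ⁅ w ⁆

  I⊆D : I ⊆ D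
  I⊆D = p⊆p∪q ⁅ w ⁆

  w∈D : w ∈ D
  w∈D = q⊆p∪q I ⁅ w ⁆ (x∈⁅x⁆ w)

  D-case : x ∈ D → x ∈ I ⊎ x ≡ w
  D-case x∈ = Sum.map₂ (x∈⁅y⁆⇒x≡y w) (x∈p∪q⁻ I ⁅ w ⁆ x∈)

  D⊆V : D ⊆ V G
  D⊆V x∈ with D-case x∈
  ... | inj₁ x∈I  = proj₁ (∖-V⁻ G w (I⊆ x∈I))
  ... | inj₂ refl = ~-vertex (~-sym a~w)

  Cyc : Graph m
  Cyc = induced G D

  in-D : z ∈ V Cyc → z ∈ D
  in-D z∈ = proj₂ (x∈p∩q⁻ (V G) D z∈)

  Cyc-edge : x ∈ D → y ∈ D → Edge G x y → Edge Cyc x y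
  Cyc-edge x∈ y∈ e = e , x∈ , y∈

  path-edge : x ∈ I → y ∈ I → Edge (G ∖ w) x y → Edge Cyc x y
  path-edge x∈ y∈ (e , _) = Cyc-edge (I⊆D x∈) (I⊆D y∈) e

  a-edge : Edge Cyc a w
  a-edge = Cyc-edge (I⊆D (path-start p)) w∈D a~w

  b-edge : Edge Cyc b w
  b-edge = Cyc-edge (I⊆D (path-end p)) w∈D b~w

  via : ∀ (H : Graph m) c → (∀ {z} → z ∈ V H → Reach H z c) → ∀ x y → x ∈ V H → y ∈ V H → Reach H x y
  via H c to x y x∈ y∈ = to x∈ ◅◅ reach-sym H (to y∈)

  reach-w : z ∈ D → Reach Cyc z w
  reach-w z∈ with D-case z∈
  ... | inj₂ refl = ε
  ... | inj₁ z∈I  = path-reach-end {K = Cyc} p path-edge z∈I ◅◅ b-edge ◅ ε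

  reach-b : z ∈ V (Cyc ∖ w) → Reach (Cyc ∖ w) z b
  reach-b z∈ with ∖-V⁻ Cyc w z∈
  ... | z∈Cyc , z≢w with D-case (in-D z∈Cyc)
  ...   | inj₂ z≡w = contradiction z≡w z≢w
  ...   | inj₁ z∈I = path-reach-end {K = Cyc ∖ w} p
    (λ x∈ y∈ e → ∖-~⁺ Cyc (path-edge x∈ y∈ e) (proj₂ (∖-V⁻ G w (I⊆ x∈))) (proj₂ (∖-V⁻ G w (I⊆ y∈)))) z∈I

  -- By `path-minus` every vertex left on the path still reaches `a` or `b`, and both are adjacent
  -- to `w`.
  reach-w-∖ : v ≢ w → z ∈ V (Cyc ∖ v) → Reach (Cyc ∖ v) z w
  reach-w-∖ {v = v} v≢w z∈ with ∖-V⁻ Cyc v z∈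
  ... | z∈Cyc , z≢v with D-case (in-D z∈Cyc)
  ...   | inj₂ refl = ε
  ...   | inj₁ z∈I with path-minus {v = v} {K = Cyc ∖ v} p
            (λ x∈ y∈ x≢v y≢v e → ∖-~⁺ Cyc (path-edge x∈ y∈ e) x≢v y≢v) z∈I z≢v
  ...     | inj₁ (a≢v , z→a) = z→a ◅◅ ∖-~⁺ Cyc a-edge a≢v (v≢w ∘ sym) ◅ ε
  ...     | inj₂ (b≢v , z→b) = z→b ◅◅ ∖-~⁺ Cyc b-edge b≢v (v≢w ∘ sym) ◅ ε

  no-cut : ∀ v → ¬ CutVertex Cyc v
  no-cut v with v ≟ᶠ w
  ... | yes refl = ¬cutVertex Cyc w (via (Cyc ∖ w) b reach-b)
  ... | no v≢w   = ¬cutVertex Cyc v (via (Cyc ∖ v) w (reach-w-∖ v≢w))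

  nonseparable : Nonseparable Cyc
  nonseparable = ((w , x∈p∩q⁺ (D⊆V w∈D , w∈D)) , via Cyc w (λ z∈ → reach-w (in-D z∈))) , no-cut

-- The edges w a and w b close a path from a to b that avoids w to a cycle, which lies in a block.
chord : ∀ (G : Graph m) → BlockGraph G → ∀ {w a b} → Edge G a w → Edge G b w → a ≢ b →
        Reach (G ∖ w) a b → Edge G a b
chord G blockGraph {w} a~w b~w a≢b r with reach⇒path (G ∖ w) r
... | I , p = nonseparable⇒complete G blockGraph D D⊆V nonseparable
                (I⊆D (path-start p)) (I⊆D (path-end p)) a≢b
  where open Cycle G a~w b~w p

-- Spanning trees

Pairs : ℕ → Set
Pairs m = Fin m × Fin m

pairs : ∀ m → List (Pairs m)
pairs m = cartesianProduct (allFin m) (allFin m)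

edge? : ∀ (G : Graph m) → Decidable (λ (e : Pairs m) → proj₁ e <ᶠ proj₂ e × Edge G (proj₁ e) (proj₂ e))
edge? G e = (proj₁ e <? proj₂ e) ×-dec Graph._~?_ G (proj₁ e) (proj₂ e)

size-∑ : ∀ (G : Graph m) → size G ≡ ∑ (pairs m) (λ e → ⟦ edge? G e ⟧)
size-∑ {m} G = length-filter (edge? G) (pairs m)

size-mono : H ⊑ G → size H ≤ size G
size-mono {m} {H} {G} (_ , f) = begin
  size H                             ≡⟨ size-∑ H ⟩
  ∑ (pairs m) (λ e → ⟦ edge? H e ⟧)  ≤⟨ ∑-mono (pairs m) (λ e → ⟦⟧-mono (λ (lt , e~) → lt , f _ _ e~) (edge? H e) (edge? G e)) ⟩
  ∑ (pairs m) (λ e → ⟦ edge? G e ⟧)  ≡⟨ size-∑ G ⟨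
  size G                             ∎
  where open ℕ.≤-Reasoning

⊑-trans : H ⊑ K → K ⊑ G → H ⊑ G
⊑-trans (V⊆ , f) (V⊆′ , g) = (λ x∈ → V⊆′ (V⊆ x∈)) , λ u v e → g u v (f u v e)

point : Fin m → Graph m
point u = record
  { V        = ⁅ u ⁆
  ; _~_      = λ _ _ → Empty.⊥
  ; _~?_     = λ _ _ → no λ ()
  ; ~-sym    = λ ()
  ; ~-irrefl = λ ()
  ; ~-vertex = λ ()
  }

size-point : ∀ (u : Fin m) → size (point u) ≡ 0
size-point {m} u = trans (size-∑ (point u)) (trans
  (∑-cong (pairs m) (λ e → ⟦⟧-no (edge? (point u) e) (λ ()))) (∑-0 (pairs m)))

connected-point : ∀ (u : Fin m) → Connected (point u)
connected-point u = (u , x∈⁅x⁆ u) , λ v w v∈ w∈ →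
  subst₂ (Reach (point u)) (sym (x∈⁅y⁆⇒x≡y u v∈)) (sym (x∈⁅y⁆⇒x≡y u w∈)) ε

module _ (T : Graph m) {x y : Fin m} (x∈ : x ∈ V T) (y∉ : y ∉ V T) where
  private
    open module T = Graph T hiding (V)

    Joins : Fin m → Fin m → Set
    Joins u v = u ≡ x × v ≡ y ⊎ u ≡ y × v ≡ x

    joins? : ∀ u v → Dec (Joins u v)
    joins? u v = ((u ≟ᶠ x) ×-dec (v ≟ᶠ y)) ⊎-dec ((u ≟ᶠ y) ×-dec (v ≟ᶠ x))

    x≢y : x ≢ y
    x≢y refl = y∉ x∈

  attach : Graph m
  attach = record
    { V        = V T ∪ ⁅ y ⁆
    ; _~_      = λ u v → u ~ v ⊎ Joins u v
    ; _~?_     = λ u v → (u ~? v) ⊎-dec joins? u v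
    ; ~-sym    = Sum.map ~-sym (Sum.swap ∘ Sum.map (λ (p , q) → q , p) (λ (p , q) → q , p))
    ; ~-irrefl = λ { (inj₁ e) → ~-irrefl e
                   ; (inj₂ (inj₁ (refl , refl))) → x≢y refl
                   ; (inj₂ (inj₂ (refl , refl))) → x≢y refl }
    ; ~-vertex = λ { (inj₁ e) → p⊆p∪q ⁅ y ⁆ (~-vertex e)
                   ; (inj₂ (inj₁ (refl , _))) → p⊆p∪q ⁅ y ⁆ x∈
                   ; (inj₂ (inj₂ (refl , _))) → q⊆p∪q (V T) ⁅ y ⁆ (x∈⁅x⁆ y) }
    }

  connected-attach : Connected T → Connected attach
  connected-attach (_ , reach) = (x , p⊆p∪q ⁅ y ⁆ x∈) , λ u v u∈ v∈ → to-x u∈ ◅◅ reach-sym attach (to-x v∈)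
    where
    to-x : u ∈ V T ∪ ⁅ y ⁆ → Reach attach u x
    to-x u∈ with x∈p∪q⁻ (V T) ⁅ y ⁆ u∈
    ... | inj₁ u∈T = gmap id inj₁ (reach _ x u∈T x∈)
    ... | inj₂ u∈y with x∈⁅y⁆⇒x≡y y u∈y
    ...   | refl = inj₂ (inj₂ (refl , refl)) ◅ ε

  attach-⊑ : T ⊑ G → Edge G x y → attach ⊑ G
  attach-⊑ {G} (V⊆ , E⊆) e = V′⊆ , λ
    { u v (inj₁ e′) → E⊆ u v e′
    ; u v (inj₂ (inj₁ (refl , refl))) → e
    ; u v (inj₂ (inj₂ (refl , refl))) → Graph.~-sym G e }
    where
    V′⊆ : V T ∪ ⁅ y ⁆ ⊆ V G
    V′⊆ u∈ with x∈p∪q⁻ (V T) ⁅ y ⁆ u∈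
    ... | inj₁ u∈T = V⊆ u∈T
    ... | inj₂ u∈y with x∈⁅y⁆⇒x≡y y u∈y
    ...   | refl = Graph.~-vertex G (Graph.~-sym G e)

  private
    _≟ᵖ_ : DecidableEquality (Pairs m)
    _≟ᵖ_ = ≡-dec _≟ᶠ_ _≟ᶠ_

    y-isolated : ∀ {u v} → u ~ v → u ≢ y × v ≢ y
    y-isolated e = (λ { refl → y∉ (~-vertex e) }) , λ { refl → y∉ (~-vertex (~-sym e)) }

    -- `size` counts an edge at its increasing pair only, so the order of `x` and `y` decides where
    -- the new edge is counted. It is new because `y` is not a vertex of `T`.
    new : Σ (Pairs m) λ e → ¬ Edge T (proj₁ e) (proj₂ e) ×
      (∀ d → (proj₁ d <ᶠ proj₂ d × Joins (proj₁ d) (proj₂ d)) ⇔ d ≡ e)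
    new with <-cmp x y
    ... | tri≈ _ x≡y _ = contradiction x≡y x≢y
    ... | tri< x<y _ x≯y = (x , y) , (λ e → proj₂ (y-isolated e) refl) , λ d → mk⇔
      (λ { (lt , inj₁ (refl , refl)) → refl ; (lt , inj₂ (refl , refl)) → contradiction lt x≯y })
      (λ { refl → x<y , inj₁ (refl , refl) })
    ... | tri> x≮y _ y<x = (y , x) , (λ e → proj₁ (y-isolated e) refl) , λ d → mk⇔
      (λ { (lt , inj₂ (refl , refl)) → refl ; (lt , inj₁ (refl , refl)) → contradiction lt x≮y })
      (λ { refl → y<x , inj₂ (refl , refl) })

  size-attach : size attach ≡ suc (size T)
  size-attach with new
  ... | e , e∉T , joins⇔ = begin
    size attach
      ≡⟨ size-∑ attach ⟩
    ∑ (pairs m) (λ d → ⟦ edge? attach d ⟧)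
      ≡⟨ ∑-cong (pairs m) (λ d → ℕ.≤-antisym
           (⟦⟧-≤-+ (λ { (lt , inj₁ d~) → inj₂ (lt , d~)
                      ; (lt , inj₂ js) → inj₁ (Equivalence.to (joins⇔ d) (lt , js)) })
             (d ≟ᵖ e) (edge? T d) (edge? attach d))
           (⟦⟧-+-≤ (λ d≡e → let lt , js = Equivalence.from (joins⇔ d) d≡e in lt , inj₂ js)
                   (λ (lt , d~) → lt , inj₁ d~)
                   (λ { refl (_ , d~) → e∉T d~ })
             (d ≟ᵖ e) (edge? T d) (edge? attach d))) ⟩
    ∑ (pairs m) (λ d → ⟦ d ≟ᵖ e ⟧ + ⟦ edge? T d ⟧)
      ≡⟨ ∑-+ (pairs m) _ _ ⟩
    ∑ (pairs m) (λ d → ⟦ d ≟ᵖ e ⟧) + ∑ (pairs m) (λ d → ⟦ edge? T d ⟧)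
      ≡⟨ cong₂ _+_ (∑-unique _≟ᵖ_ (Unique.cartesianProduct⁺ (Unique.allFin⁺ m) (Unique.allFin⁺ m))
                      (∈-cartesianProduct⁺ (∈-allFin (proj₁ e)) (∈-allFin (proj₂ e))))
                   (sym (size-∑ T)) ⟩
    suc (size T) ∎
    where open ≡-Reasoning

-- Attaching a leaf adds one vertex and one edge. When no edge of `G` leaves `T`, reachability puts
-- every vertex in `T`. Acyclicity is not stated; the relation between order and size stands in for
-- it.
spanningTree : ∀ (G : Graph m) → Connected G →
  ∃ λ T → T ⊑ G × V T ≡ V G × Connected T × suc (size T) ≡ ∣ V G ∣
spanningTree {m} G ((r , r∈) , reach) = grow (point r) (⊃-wellFounded _) (x∈⁅x⁆ r)
  ((λ x∈ → subst (_∈ V G) (sym (x∈⁅y⁆⇒x≡y r x∈)) r∈) , λ _ _ ())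
  (connected-point r) (trans (cong suc (size-point r)) (sym (∣⁅x⁆∣≡1 r)))
  where
  grow : ∀ T → Acc (λ P Q → Q ⊂ P) (V T) → r ∈ V T → T ⊑ G → Connected T → suc (size T) ≡ ∣ V T ∣ →
         ∃ λ T → T ⊑ G × V T ≡ V G × Connected T × suc (size T) ≡ ∣ V G ∣
  grow T (acc rec) r∈T T⊑G conn eq
    with any? (λ x → any? (λ y → (x ∈? V T) ×-dec ¬? (y ∈? V T) ×-dec Graph._~?_ G x y))
  ... | yes (x , y , x∈ , y∉ , e) = grow (attach T x∈ y∉)
          (rec (p⊆p∪q ⁅ y ⁆ , y , q⊆p∪q (V T) ⁅ y ⁆ (x∈⁅x⁆ y) , y∉))
          (p⊆p∪q ⁅ y ⁆ r∈T) (attach-⊑ T x∈ y∉ {G} T⊑G e) (connected-attach T x∈ y∉ conn)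
          (trans (cong suc (trans (size-attach T x∈ y∉) eq)) (sym (∣∪⁅⁆∣ (V T) y y∉)))
  ... | no none = T , T⊑G , VT≡ , conn , trans eq (cong ∣_∣ VT≡)
    where
    VT≡ : V T ≡ V G
    VT≡ = ⊆-antisym (proj₁ T⊑G) (λ {v} v∈ → reach-closed G (V T) none r∈T (reach r v r∈ v∈))

order≤size+1 : ∀ (G : Graph m) → Connected G → ∣ V G ∣ ≤ suc (size G)
order≤size+1 G conn with spanningTree G conn
... | T , T⊑G , _ , _ , eq = ℕ.≤-trans (ℕ.≤-reflexive (sym eq)) (s≤s (size-mono {H = T} {G} T⊑G))

-- Minimal connected sets

-- A walk in `H` from `u` never leaves the component. Inducing in `G` and not in `H` gives the set
-- the form in which it can compete with `X` in `Minimal`.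
connected-component : ∀ (G H : Graph m) → H ⊑ G → u ∈ V H → Connected (induced G (component H u))
connected-component {u = u} G H H⊑G u∈ = (u , x∈p∩q⁺ (proj₁ H⊑G u∈ , self)) ,
  λ x y x∈ y∈ → reach-sym (induced G Y) (from-u x x∈) ◅◅ from-u y y∈
  where
  Y : Subset _
  Y = component H u
  self : u ∈ Y
  self = ∈⁅∣⁆⁺ (reach? H u) ε
  stay : ∀ {x y} → Reach H u x → Reach H x y → Reach (induced G Y) x y
  stay u→x ε = ε
  stay u→x (e ◅ es) = (proj₂ H⊑G _ _ e , ∈⁅∣⁆⁺ (reach? H u) u→x , ∈⁅∣⁆⁺ (reach? H u) u→j) ◅ stay u→j es
    where u→j = u→x ◅◅ (e ◅ ε)
  from-u : ∀ x → x ∈ V (induced G Y) → Reach (induced G Y) u x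
  from-u x x∈ = stay ε (∈⁅∣⁆⁻ (reach? H u) (proj₂ (x∈p∩q⁻ (V G) Y x∈)))

-- Minimal under inclusion, not in size: that is enough for `minimal⇒split`, which leaves in `X`
-- only `S` and its separators, and these lie in every connected subgraph containing `S`.
record Minimal (G : Graph m) (S X : Subset m) : Set where
  field
    ⊆V        : X ⊆ V G
    S⊆        : S ⊆ X
    connected : Connected (induced G X)
    minimal   : ∀ Y → S ⊆ Y → Connected (induced G Y) → ¬ (Y ⊂ X)

minimal-⊆V : ∀ (G : Graph m) S → Connected G → S ⊆ V G → ∃ (Minimal G S)
minimal-⊆V {m} G S conn S⊆V = go (V G) (⊂-wellFounded _) id S⊆V
  (connected-cong G (induced G (V G))
    ((λ x∈ → x∈p∩q⁺ (x∈ , x∈)) , λ u v e → e , Graph.~-vertex G e , Graph.~-vertex G (Graph.~-sym G e))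
    (induced-⊑ G (V G)) conn)
  where
  go : ∀ X → Acc _⊂_ X → X ⊆ V G → S ⊆ X → Connected (induced G X) → ∃ (Minimal G S)
  go X (acc rec) X⊆ S⊆X connX
    with anySubset? (λ Y → (S ⊆? Y) ×-dec connected? (induced G Y) ×-dec (Y ⊂? X))
  ... | yes (Y , S⊆Y , connY , Y⊂X) = go Y (rec Y⊂X) (λ x∈ → X⊆ (proj₁ Y⊂X x∈)) S⊆Y connY
  ... | no none = X , record { ⊆V = X⊆ ; S⊆ = S⊆X ; connected = connX
                             ; minimal = λ Y S⊆Y connY Y⊂X → none (Y , S⊆Y , connY , Y⊂X) }

-- The walk is stopped just before it first arrives at `v`.
reach-before : ∀ (G : Graph m) → Reach G x v → x ≢ v → ∃ λ a → Edge G a v × Reach (G ∖ v) x a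
reach-before G ε x≢v = contradiction refl x≢v
reach-before {v = v} G (_◅_ {j = j} e es) x≢v with j ≟ᶠ v
... | yes refl = _ , e , ε
... | no j≢v with reach-before G es j≢v
...   | a , a~v , r = a , a~v , ∖-~⁺ G e x≢v j≢v ◅ r

∖-mono : ∀ {H G : Graph m} v → H ⊑ G → H ∖ v ⊑ G ∖ v
∖-mono {H = H} {G} v (V⊆ , E⊆) =
  (λ x∈ → let x∈H , x≢v = ∖-V⁻ H v x∈ in ∖-V⁺ G (V⊆ x∈H) x≢v) ,
  λ x y (e , x∈ , y∈) → ∖-~⁺ G (E⊆ x y e) (≢v x∈) (≢v y∈)
  where
  ≢v : x ∈ V H - v → x ≢ v
  ≢v x∈ refl = ∉-- (V H) v x∈

-- If v did not separate S in G, then the neighbours of v on two paths in X from v to S would be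
-- adjacent by chord, so that the component of X - v containing one point of S would contain all of S.
minimal⇒split : ∀ (G : Graph m) → BlockGraph G → Minimal G S X → Nonempty S → v ∈ X → v ∉ S → Split (G ∖ v) S
minimal⇒split {m} {S} {X} {v} G blockGraph min (s , s∈S) v∈X v∉S =
  (λ x∈ → ∖-V⁺ G (⊆V (S⊆ x∈)) (≢v x∈)) , All.tabulate unsplit
  where
  open Minimal min
  ≢v : x ∈ S → x ≢ v
  ≢v x∈ refl = v∉S x∈
  GX GX∖v : Graph m
  GX   = induced G X
  GX∖v = GX ∖ v
  in-GX : x ∈ X → x ∈ V GX
  in-GX x∈ = x∈p∩q⁺ (⊆V x∈ , x∈)
  neighbour : x ∈ S → ∃ λ a → Edge GX a v × Reach GX∖v x a
  neighbour {x} x∈ = reach-before GX (proj₂ connected x v (in-GX (S⊆ x∈)) (in-GX v∈X)) (≢v x∈)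
  up : Reach GX∖v x y → Reach (G ∖ v) x y
  up = reach-mono {H = GX∖v} {G = G ∖ v} (∖-mono {H = GX} {G} v (induced-⊑ G X))
  Y : Subset m
  Y = component GX∖v s
  s∈GX∖v : s ∈ V GX∖v
  s∈GX∖v = ∖-V⁺ GX (in-GX (S⊆ s∈S)) (≢v s∈S)
  Y⊂X : Y ⊂ X
  Y⊂X = (λ y∈ → proj₂ (x∈p∩q⁻ (V G) X (proj₁ (Y⁻ y∈)))) , v , v∈X , λ v∈Y → proj₂ (Y⁻ v∈Y) refl
    where
    Y⁻ : y ∈ Y → y ∈ V GX × y ≢ v
    Y⁻ y∈ = ∖-V⁻ GX v (reach-V GX∖v s∈GX∖v (∈⁅∣⁆⁻ (reach? GX∖v s) y∈))
  unsplit : ∀ {Z} → Z ∈ˡ components (G ∖ v) → S ⊈ Z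
  unsplit {Z} Z∈ S⊆Z = minimal Y (λ t∈ → ∈⁅∣⁆⁺ (reach? GX∖v s) (s→ t∈))
    (connected-component G GX∖v (⊑-trans {H = GX∖v} {GX} {G} (∖-⊑ GX v) (induced-⊑ G X)) s∈GX∖v) Y⊂X
    where
    s→ : ∀ {t} → t ∈ S → Reach GX∖v s t
    s→ {t} t∈ with neighbour s∈S | neighbour t∈
    ... | a , (a~v , a∈X , _) , s→a | b , (b~v , b∈X , _) , t→b with a ≟ᶠ b
    ...   | yes refl = s→a ◅◅ reach-sym GX∖v t→b
    -- The edge `a~b` belongs to `G`, but both its ends lie in `X` and differ from `v`, so it
    -- remains available and replaces the detour through `v`.
    ...   | no  a≢b  = s→a ◅◅ ∖-~⁺ GX (a~b , a∈X , b∈X) (≢ a~v) (≢ b~v) ◅ reach-sym GX∖v t→b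
      where
      ≢ : Edge G x v → x ≢ v
      ≢ e refl = Graph.~-irrefl G e
      a→b : Reach (G ∖ v) a b
      a→b = reach-sym (G ∖ v) (up s→a) ◅◅
            isComponent-reach (G ∖ v) (∈-components⁻ (G ∖ v) Z∈) (S⊆Z s∈S) (S⊆Z t∈) ◅◅ up t→b
      a~b : Edge G a b
      a~b = chord G blockGraph a~v b~v a≢b a→b

-- Steiner distances

-- If `K` missed `v`, it would survive the deletion of `v` and keep all of `S` in one component.
split⇒∈ : ∀ (G K : Graph m) → K ⊑ G → Connected K → S ⊆ V K → Nonempty S → Split (G ∖ v) S → v ∈ V K
split⇒∈ {S = S} {v = v} G K K⊑G (_ , reach) S⊆K (s , s∈S) (S⊆ , S⊈) = decidable-stable (v ∈? V K) λ v∉K →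
  let ≢v : ∀ {x} → x ∈ V K → x ≢ v
      ≢v x∈ = λ { refl → v∉K x∈ }
      K⊑ : K ⊑ G ∖ v
      K⊑ = (λ x∈ → ∖-V⁺ G (proj₁ K⊑G x∈) (≢v x∈)) ,
           λ x y e → ∖-~⁺ G (proj₂ K⊑G x y e) (≢v (Graph.~-vertex K e)) (≢v (Graph.~-vertex K (Graph.~-sym K e)))
  in All.lookup S⊈ (component-∈ (G ∖ v) (S⊆ s∈S)) λ {t} t∈ →
       ∈⁅∣⁆⁺ (reach? (G ∖ v) s) (reach-mono {H = K} {G = G ∖ v} K⊑ (reach s t (S⊆K s∈S) (S⊆K t∈)))

-- `Split` includes that `S` avoids `v`. Thus `S` and its separators are disjoint, and their sizes
-- add up.
Separates : Graph m → Subset m → Fin m → Set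
Separates G S v = v ∈ V G × Split (G ∖ v) S

separates? : ∀ (G : Graph m) S → Decidable (Separates G S)
separates? G S v = (v ∈? V G) ×-dec Split? (G ∖ v) S

steinerDistance-separates : ∀ (G : Graph m) → Connected G → BlockGraph G → ∀ S → S ⊆ V G → Nonempty S →
  suc (steinerDistance G S) ≡ ∣ S ∣ + ∑ (allFin m) (λ v → ⟦ separates? G S v ⟧)
steinerDistance-separates {m} G conn blockGraph S S⊆V S≠∅ = ℕ.≤-antisym upper lower
  where
  open IsSteinerDistance (steinerDistance-spec G conn S S⊆V)
  open ℕ.≤-Reasoning
  count : ∣ S ∣ + ∑ (allFin m) (λ v → ⟦ separates? G S v ⟧) ≡
          ∑ (allFin m) (λ v → ⟦ v ∈? S ⟧ + ⟦ separates? G S v ⟧)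
  count = trans (cong (_+ ∑ (allFin m) (λ v → ⟦ separates? G S v ⟧)) (∣∣-∑ S))
                (sym (∑-+ (allFin m) (λ v → ⟦ v ∈? S ⟧) (λ v → ⟦ separates? G S v ⟧)))
  lower : ∣ S ∣ + ∑ (allFin m) (λ v → ⟦ separates? G S v ⟧) ≤ suc (steinerDistance G S)
  lower with attained
  ... | K , K⊑G , connK , S⊆K , size≡ = begin
    ∣ S ∣ + ∑ (allFin m) (λ v → ⟦ separates? G S v ⟧)
      ≡⟨ count ⟩
    ∑ (allFin m) (λ v → ⟦ v ∈? S ⟧ + ⟦ separates? G S v ⟧)
      ≤⟨ ∑-mono (allFin m) (λ v → ⟦⟧-+-≤ S⊆K
           (λ (_ , split) → split⇒∈ G K K⊑G connK S⊆K S≠∅ split)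
           (λ v∈S (_ , split) → proj₂ (∖-V⁻ G v (proj₁ split v∈S)) refl)
           (v ∈? S) (separates? G S v) (v ∈? V K)) ⟩
    ∑ (allFin m) (λ v → ⟦ v ∈? V K ⟧)
      ≡⟨ ∣∣-∑ (V K) ⟨
    ∣ V K ∣
      ≤⟨ order≤size+1 K connK ⟩
    suc (size K)
      ≡⟨ cong suc size≡ ⟩
    suc (steinerDistance G S) ∎
  upper : suc (steinerDistance G S) ≤ ∣ S ∣ + ∑ (allFin m) (λ v → ⟦ separates? G S v ⟧)
  upper with minimal-⊆V G S conn S⊆V
  ... | X , min with spanningTree (induced G X) (Minimal.connected min)
  ...   | T , T⊑ , VT≡ , connT , size≡ = begin
    suc (steinerDistance G S)
      ≤⟨ s≤s (minimal T (⊑-trans {H = T} {induced G X} {G} T⊑ (induced-⊑ G X)) connT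
           (λ x∈ → subst (_ ∈_) (sym VT≡) (x∈p∩q⁺ (S⊆V x∈ , Minimal.S⊆ min x∈)))) ⟩
    suc (size T)
      ≡⟨ size≡ ⟩
    ∣ V G ∩ X ∣
      ≤⟨ ∣p∩q∣≤∣q∣ (V G) X ⟩
    ∣ X ∣
      ≡⟨ ∣∣-∑ X ⟩
    ∑ (allFin m) (λ v → ⟦ v ∈? X ⟧)
      ≤⟨ ∑-mono (allFin m) (λ v → ⟦⟧-≤-+ (in-X v) (v ∈? S) (separates? G S v) (v ∈? X)) ⟩
    ∑ (allFin m) (λ v → ⟦ v ∈? S ⟧ + ⟦ separates? G S v ⟧)
      ≡⟨ count ⟨
    ∣ S ∣ + ∑ (allFin m) (λ v → ⟦ separates? G S v ⟧) ∎
    where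
    in-X : ∀ v → v ∈ X → v ∈ S ⊎ Separates G S v
    in-X v v∈X with v ∈? S
    ... | yes v∈S = inj₁ v∈S
    ... | no  v∉S = inj₂ (Minimal.⊆V min v∈X , minimal⇒split G blockGraph min S≠∅ v∈X v∉S)

-- Summation over the sets of size k

-- Double counting in the abstract: `p` selects the sets of size `k`, `d` is the Steiner distance,
-- `σ` tells whether a vertex separates a set, `r` is the contribution of one vertex, and `c` and
-- `t` become `k ∸ 1` and the number of selected sets.
∑-exchange : ∀ {A B : Set} (xs : List A) (ys : List B) (p d : A → ℕ) (σ : A → B → ℕ) (r : B → ℕ) c t →
  (∀ x → p x * d x ≡ p x * ∑ ys (σ x) + c * p x) →
  (∀ y → ∑ xs (λ x → p x * σ x y) ≡ r y) → ∑ xs p ≡ t →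
  ∑ xs (λ x → p x * d x) ≡ ∑ ys r + c * t
∑-exchange xs ys p d σ r c t pd≡ pσ≡ p≡ = begin
  ∑ xs (λ x → p x * d x)
    ≡⟨ ∑-cong xs (λ x → trans (pd≡ x) (cong (_+ c * p x) (*-∑ (p x) ys (σ x)))) ⟩
  ∑ xs (λ x → ∑ ys (λ y → p x * σ x y) + c * p x)
    ≡⟨ ∑-+ xs _ _ ⟩
  ∑ xs (λ x → ∑ ys (λ y → p x * σ x y)) + ∑ xs (λ x → c * p x)
    ≡⟨ cong₂ _+_ (trans (∑-swap xs ys _) (∑-cong ys pσ≡)) (trans (sym (*-∑ c xs p)) (cong (c *_) p≡)) ⟩
  ∑ ys r + c * t ∎
  where open ≡-Reasoning

ofSize? : ∀ (X : Subset m) k S → Dec (S ⊆ X × ∣ S ∣ ≡ k)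
ofSize? X k S = (S ⊆? X) ×-dec (∣ S ∣ ℕ.≟ k)

∑-ofSize : ∀ (X : Subset m) k → ∑ (subsets m) (λ S → ⟦ ofSize? X k S ⟧) ≡ ∣ X ∣ C k
∑-ofSize {m} X k = begin
  ∑ (subsets m) (λ S → ⟦ ofSize? X k S ⟧)
    ≡⟨ ∑-cong (subsets m) (λ S → ⟦⟧-× (S ⊆? X) (∣ S ∣ ℕ.≟ k)) ⟩
  ∑ (subsets m) (λ S → ⟦ S ⊆? X ⟧ * ⟦ ∣ S ∣ ℕ.≟ k ⟧)
    ≡⟨ ∑-subsets X _ ⟩
  ∑ (powerset X) (λ S → ⟦ ∣ S ∣ ℕ.≟ k ⟧)
    ≡⟨ ∑-∣∣-C X k ⟩
  ∣ X ∣ C k ∎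
  where open ≡-Reasoning

1≤∣∣⇒nonempty : ∀ (S : Subset m) → 1 ≤ ∣ S ∣ → Nonempty S
1≤∣∣⇒nonempty {m} S 1≤∣S∣ with nonempty? S
... | yes S≠∅ = S≠∅
... | no  S=∅ = contradiction (subst (λ T → 1 ≤ ∣ T ∣) (Empty-unique S=∅) 1≤∣S∣)
                  (subst (λ c → ¬ (1 ≤ c)) (sym (∣⊥∣≡0 m)) (λ ()))

-- For a cut vertex this is `N-split`; any other vertex separates no nonempty set, by
-- `split⇒cutVertex`, and `1 ≤ k` makes the sets nonempty.
∑-separated : ∀ (G : Graph m) k → Connected G → 1 ≤ k → ∀ v →
  ∑ (subsets m) (λ S → ⟦ ofSize? (V G) k S ⟧ * ⟦ separates? G S v ⟧) ≡ ⟦ cutVertex? G v ⟧ * N k (G ∖ v)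
∑-separated {m} G k conn 1≤k v = begin
  ∑ (subsets m) (λ S → ⟦ ofSize? (V G) k S ⟧ * ⟦ separates? G S v ⟧)
    ≡⟨ ∑-cong (subsets m) pointwise ⟩
  ∑ (subsets m) (λ S → ⟦ cutVertex? G v ⟧ * (⟦ Split? (G ∖ v) S ⟧ * ⟦ ∣ S ∣ ℕ.≟ k ⟧))
    ≡⟨ *-∑ ⟦ cutVertex? G v ⟧ (subsets m) _ ⟨
  ⟦ cutVertex? G v ⟧ * ∑ (subsets m) (λ S → ⟦ Split? (G ∖ v) S ⟧ * ⟦ ∣ S ∣ ℕ.≟ k ⟧)
    ≡⟨ cong (⟦ cutVertex? G v ⟧ *_) (N-split k (G ∖ v)) ⟨
  ⟦ cutVertex? G v ⟧ * N k (G ∖ v) ∎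
  where
  open ≡-Reasoning
  both : ∀ S → ((S ⊆ V G × ∣ S ∣ ≡ k) × Separates G S v) ⇔ (CutVertex G v × Split (G ∖ v) S × ∣ S ∣ ≡ k)
  both S = mk⇔
    (λ ((_ , ∣S∣≡k) , v∈V , split) →
      split⇒cutVertex {S = S} G conn v∈V (1≤∣∣⇒nonempty S (subst (1 ≤_) (sym ∣S∣≡k) 1≤k)) split , split , ∣S∣≡k)
    (λ (cut , split , ∣S∣≡k) →
      ((λ x∈ → proj₁ (∖-V⁻ G v (proj₁ split x∈))) , ∣S∣≡k) , proj₁ cut , split)
  pointwise : ∀ S → ⟦ ofSize? (V G) k S ⟧ * ⟦ separates? G S v ⟧ ≡
                    ⟦ cutVertex? G v ⟧ * (⟦ Split? (G ∖ v) S ⟧ * ⟦ ∣ S ∣ ℕ.≟ k ⟧)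
  pointwise S = ⟦⟧-×-cong (both S) (ofSize? (V G) k S) (separates? G S v)
                          (cutVertex? G v) (Split? (G ∖ v) S) (∣ S ∣ ℕ.≟ k)

steinerDistance-weighted : ∀ (G : Graph m) k → Connected G → BlockGraph G → 1 ≤ k → ∀ S →
  ⟦ ofSize? (V G) k S ⟧ * steinerDistance G S ≡
  ⟦ ofSize? (V G) k S ⟧ * ∑ (allFin m) (λ v → ⟦ separates? G S v ⟧) + (k ∸ 1) * ⟦ ofSize? (V G) k S ⟧
steinerDistance-weighted {m} G k conn blockGraph 1≤k S =
  ⟦⟧-* (ofSize? (V G) k S) λ (S⊆V , ∣S∣≡k) → begin
    -- This reduces to `steinerDistance G S`. Since `1 ≤ k`, the truncated subtraction can be moved
    -- onto the summand `k`.
    suc (steinerDistance G S) ∸ 1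
      ≡⟨ cong (_∸ 1) (steinerDistance-separates G conn blockGraph S S⊆V
           (1≤∣∣⇒nonempty S (subst (1 ≤_) (sym ∣S∣≡k) 1≤k))) ⟩
    (∣ S ∣ + ∑ (allFin m) (λ v → ⟦ separates? G S v ⟧)) ∸ 1
      ≡⟨ cong (λ c → (c + ∑ (allFin m) (λ v → ⟦ separates? G S v ⟧)) ∸ 1) ∣S∣≡k ⟩
    (k + ∑ (allFin m) (λ v → ⟦ separates? G S v ⟧)) ∸ 1
      ≡⟨ ℕ.+-∸-comm _ 1≤k ⟩
    (k ∸ 1) + ∑ (allFin m) (λ v → ⟦ separates? G S v ⟧)
      ≡⟨ ℕ.+-comm (k ∸ 1) _ ⟩
    ∑ (allFin m) (λ v → ⟦ separates? G S v ⟧) + (k ∸ 1) ∎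
  where
  open ≡-Reasoning
  ⟦⟧-* : (p : Dec P) → ∀ {d σ c} → (P → d ≡ σ + c) → ⟦ p ⟧ * d ≡ ⟦ p ⟧ * σ + c * ⟦ p ⟧
  ⟦⟧-* (no _)  {c = c}     d≡ = sym (ℕ.*-zeroʳ c)
  ⟦⟧-* (yes x) {d} {σ} {c} d≡ = trans (ℕ.*-identityˡ d) (trans (d≡ x)
    (cong₂ _+_ (sym (ℕ.*-identityˡ σ)) (sym (ℕ.*-identityʳ c))))

SW-∑ : ∀ (G : Graph m) k → SW k G ≡ ∑ (subsets m) (λ S → ⟦ ofSize? (V G) k S ⟧ * steinerDistance G S)
SW-∑ {m} G k = ∑-filter (ofSize? (V G) k) (subsets m) (steinerDistance G)

∑-cutVertices : ∀ (G : Graph m) f →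
  ∑ (cutVertices G) f ≡ ∑ (allFin m) (λ v → ⟦ cutVertex? G v ⟧ * f v)
∑-cutVertices {m} G f = ∑-filter (cutVertex? G) (allFin m) f

∑-steinerDistance : ∀ (G : Graph m) k → Connected G → BlockGraph G → 1 ≤ k →
  ∑ (subsets m) (λ S → ⟦ ofSize? (V G) k S ⟧ * steinerDistance G S) ≡
  ∑ (allFin m) (λ v → ⟦ cutVertex? G v ⟧ * N k (G ∖ v)) + (k ∸ 1) * (∣ V G ∣ C k)
∑-steinerDistance {m} G k conn blockGraph 1≤k =
  ∑-exchange (subsets m) (allFin m) (λ S → ⟦ ofSize? (V G) k S ⟧) (steinerDistance G)
    (λ S v → ⟦ separates? G S v ⟧) (λ v → ⟦ cutVertex? G v ⟧ * N k (G ∖ v)) (k ∸ 1) (∣ V G ∣ C k)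
    (steinerDistance-weighted G k conn blockGraph 1≤k)
    (∑-separated G k conn 1≤k) (∑-ofSize (V G) k)

mainTheorem4 : ∀ {m : ℕ} (G : Graph m) (n k : ℕ) →
    Connected G → BlockGraph G → ∣ V G ∣ ≡ n → 2 ≤ k → k ≤ n →
    SW k G ≡ sum (map (λ v → N k (G ∖ v)) (cutVertices G)) + (k ∸ 1) * (n C k)
mainTheorem4 G _ k conn blockGraph refl 2≤k _ =
  trans (SW-∑ G k) (trans
    (∑-steinerDistance G k conn blockGraph (ℕ.<⇒≤ 2≤k))
    (cong (_+ (k ∸ 1) * (∣ V G ∣ C k)) (sym (∑-cutVertices G (λ v → N k (G ∖ v))))))
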